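{- For every integer $n\ge 6$, $MB(\overline{P_n})=3$. Equivalently, for every integer $n\ge 6$, there is a matrix in $\mathcal{S}(\overline{P_n})$ that is an orthogonal projection of rank three, and no matrix in $\mathcal{S}(\overline{P_n})$ is an orthogonal projection of rank one or two.
   Context: $P_n$ is the path on vertices $1,\dots,n$ with edges $\{i,i+1\}$ for $1\le i<n$, and $\overline{P_n}$ is its complement. For a simple graph $G$ on vertices $1,\dots,n$, $\mathcal{S}(G)$ is the set of real symmetric $n\times n$ matrices $A=[a_{ij}]$ such that for all $i\ne j$: $a_{ij}\ne 0$ if and only if $\{i,j\}\in E(G)$ (no restriction on the diagonal). A realization of $G$ is a matrix in $\mathcal{S}(G)$. $q(A)$ is the number of distinct eigenvalues of $A$, and $q(G)=\min\{q(A):A\in\mathcal{S}(G)\}$. When $q(G)=2$: for an integer $k$ with $1\le k\le\lfloor n/2\rfloor$, the bipartition $[n-k,k]$ is called achievable by $G$ if some $A\in\mathcal{S}(G)$ has exactly two distinct eigenvalues, with multiplicities $n-k$ and $k$. Then $MB(G)=\min\{k:[n-k,k]\text{ is achievable by }G\}$; $MB(G)$ is defined only when $q(G)=2$, so the claim $MB(\overline{P_n})=3$ includes $q(\overline{P_n})=2$. An orthogonal projection is a real symmetric matrix $P$ with $P^2=P$. -}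

module Defs where

open import Algebra.Bundles using (CommutativeRing)
open import Algebra.Core using (Op₁; Op₂)
import Algebra.Definitions as AlgebraDefinitions
import Algebra.Definitions.RawMonoid as RawMonoidDefinitions
open import Algebra.Structures using (IsCommutativeRing)
open import Data.Fin.Base using (Fin; zero; suc; toℕ)
open import Data.Nat.Base as ℕ using (ℕ; ⌊_/2⌋; _∸_)
open import Data.Nat.Properties using (1+n≢n)
open import Data.Product.Base using (∃; ∃-syntax; _×_; _,_)
open import Data.Sum.Base using (_⊎_; inj₁; inj₂; swap)
open import Data.Vec.Functional using (Vector; replicate)
import Data.Vec.Functional.Relation.Binary.Equality.Setoid as VectorEquality
open import Function.Base using (_∘_)
open import Function.Bundles using (_⇔_)
open import Function.Definitions using (Injective)
open import Level using (Level; _⊔_; 0ℓ) renaming (suc to lsuc)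
open import Relation.Binary.Core using (Rel)
import Relation.Binary.Construct.StrictToNonStrict as StrictToNonStrict
open import Relation.Binary.Definitions using (Symmetric; Irreflexive)
open import Relation.Binary.PropositionalEquality.Core using (_≡_; _≢_; refl; ≢-sym)
open import Relation.Binary.Structures using (IsStrictTotalOrder)
open import Relation.Nullary.Negation using (¬_)

-- The real numbers, given by their classical axioms: a totally ordered
-- field in which every inhabited subset that is bounded above has a
-- least upper bound.  The order is trichotomous (hence ≈ is decidable),
-- as it is for the classical reals.
record RealNumbers (c ℓ₁ ℓ₂ : Level) : Set (lsuc (c ⊔ ℓ₁ ⊔ ℓ₂)) where
  infix  4 _≈_ _<_
  infixl 6 _+_
  infixl 7 _*_
  infix  8 -_
  field
    Carrier           : Set c
    _≈_               : Rel Carrier ℓ₁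
    _<_               : Rel Carrier ℓ₂
    _+_ _*_           : Op₂ Carrier
    -_                : Op₁ Carrier
    0# 1#             : Carrier
    isCommutativeRing : IsCommutativeRing _≈_ _+_ _*_ -_ 0# 1#
    0≉1               : ¬ (0# ≈ 1#)
    ≉0⇒invertible     : ∀ x → ¬ (x ≈ 0#) → AlgebraDefinitions.Invertible _≈_ 1# _*_ x

    isStrictTotalOrder : IsStrictTotalOrder _≈_ _<_
    +-monoˡ-<          : ∀ {x y} z → x < y → x + z < y + z
    *-pos              : ∀ {x y} → 0# < x → 0# < y → 0# < x * y

  open StrictToNonStrict _≈_ _<_ public using (_≤_)

  UpperBound : ∀ {p} → (Carrier → Set p) → Carrier → Set (c ⊔ ℓ₁ ⊔ ℓ₂ ⊔ p)
  UpperBound P b = ∀ x → P x → x ≤ b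

  field
    complete : (P : Carrier → Set (c ⊔ ℓ₁ ⊔ ℓ₂)) → ∃ P → ∃ (UpperBound P) →
               ∃[ s ] UpperBound P s × (∀ b → UpperBound P b → s ≤ b)

  commutativeRing : CommutativeRing c ℓ₁
  commutativeRing = record { isCommutativeRing = isCommutativeRing }

record SimpleGraph (n : ℕ) : Set₁ where
  field
    Adj         : Rel (Fin n) 0ℓ
    adj-sym     : Symmetric Adj
    adj-irrefl  : Irreflexive _≡_ Adj

complement : ∀ {n} → SimpleGraph n → SimpleGraph n
complement G = record
  { Adj        = λ i j → i ≢ j × ¬ Adj i j
  ; adj-sym    = λ (i≢j , ¬ij) → ≢-sym i≢j , ¬ij ∘ adj-sym
  ; adj-irrefl = λ i≡j (i≢j , _) → i≢j i≡j
  }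
  where open SimpleGraph G

-- Vertices are numbered from 0 instead of from 1.
path : ∀ n → SimpleGraph n
path n = record
  { Adj        = λ i j → ℕ.suc (toℕ i) ≡ toℕ j ⊎ ℕ.suc (toℕ j) ≡ toℕ i
  ; adj-sym    = swap
  ; adj-irrefl = λ { refl (inj₁ e) → 1+n≢n e ; refl (inj₂ e) → 1+n≢n e }
  }

IsMinimum : ∀ {p} → (ℕ → Set p) → ℕ → Set p
IsMinimum P k = P k × (∀ m → P m → k ℕ.≤ m)

module _ {c ℓ₁ ℓ₂ : Level} (ℝ : RealNumbers c ℓ₁ ℓ₂) where
  open RealNumbers ℝ using (Carrier; _≈_; _*_; 0#; commutativeRing)
  open CommutativeRing commutativeRing using (setoid; +-rawMonoid)
  open VectorEquality setoid using (_≋_)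
  open RawMonoidDefinitions +-rawMonoid using (sum)

  Matrix : ℕ → Set c
  Matrix n = Fin n → Fin n → Carrier

  mulVec : ∀ {n} → Matrix n → Vector Carrier n → Vector Carrier n
  mulVec A v i = sum (λ j → A i j * v j)

  mulMat : ∀ {n} → Matrix n → Matrix n → Matrix n
  mulMat A B i j = sum (λ k → A i k * B k j)

  scale : ∀ {n} → Carrier → Vector Carrier n → Vector Carrier n
  scale a v i = a * v i

  combination : ∀ {n k} → Vector Carrier k → Vector (Vector Carrier n) k → Vector Carrier n
  combination a b i = sum (λ j → a j * b j i)

  record IsBasis {n k : ℕ} {p : Level} (S : Vector Carrier n → Set p)
                 (b : Vector (Vector Carrier n) k) : Set (c ⊔ ℓ₁ ⊔ p) where
    field
      member      : ∀ j → S (b j)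
      independent : ∀ a → combination a b ≋ replicate n 0# → a ≋ replicate k 0#
      spanning    : ∀ v → S v → ∃[ a ] v ≋ combination a b

  HasDimension : ∀ {n p} → (Vector Carrier n → Set p) → ℕ → Set (c ⊔ ℓ₁ ⊔ p)
  HasDimension {n} S k = ∃[ b ] IsBasis {n} {k} S b

  ColumnSpace : ∀ {n} → Matrix n → Vector Carrier n → Set (c ⊔ ℓ₁)
  ColumnSpace A v = ∃[ x ] mulVec A x ≋ v

  HasRank : ∀ {n} → Matrix n → ℕ → Set (c ⊔ ℓ₁)
  HasRank A = HasDimension (ColumnSpace A)

  Eigenspace : ∀ {n} → Matrix n → Carrier → Vector Carrier n → Set ℓ₁
  Eigenspace A x v = mulVec A v ≋ scale x v

  IsEigenvalue : ∀ {n} → Matrix n → Carrier → Set (c ⊔ ℓ₁)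
  IsEigenvalue {n} A x = ∃[ v ] ¬ (v ≋ replicate n 0#) × Eigenspace A x v

  -- Used for symmetric matrices only, where the geometric and the
  -- algebraic multiplicity coincide.
  HasMultiplicity : ∀ {n} → Matrix n → Carrier → ℕ → Set (c ⊔ ℓ₁)
  HasMultiplicity A x = HasDimension (Eigenspace A x)

  record DistinctEigenvalues {n m : ℕ} (A : Matrix n) (e : Vector Carrier m)
                             : Set (c ⊔ ℓ₁) where
    field
      distinct    : Injective _≡_ _≈_ e
      eigenvalues : ∀ i → IsEigenvalue A (e i)
      exhaustive  : ∀ x → IsEigenvalue A x → ∃[ i ] e i ≈ x

  IsSymmetric : ∀ {n} → Matrix n → Set ℓ₁
  IsSymmetric A = ∀ i j → A i j ≈ A j i

  record IsOrthogonalProjection {n : ℕ} (P : Matrix n) : Set ℓ₁ where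
    field
      symmetric  : IsSymmetric P
      idempotent : ∀ i j → mulMat P P i j ≈ P i j

  -- A ∈ 𝒮(G).
  record Realizes {n : ℕ} (G : SimpleGraph n) (A : Matrix n) : Set ℓ₁ where
    open SimpleGraph G
    field
      symmetric : IsSymmetric A
      pattern-⇔ : ∀ i j → i ≢ j → (¬ (A i j ≈ 0#)) ⇔ Adj i j

  -- The parameters q and MB are given as relations: IsQᴹ A m reads
  -- "q(A) = m", IsQ G m reads "q(G) = m", and IsMB G k reads "MB(G) is
  -- defined and equals k".

  IsQᴹ : ∀ {n} → Matrix n → ℕ → Set (c ⊔ ℓ₁)
  IsQᴹ A m = ∃[ e ] DistinctEigenvalues {m = m} A e

  IsQ : ∀ {n} → SimpleGraph n → ℕ → Set (c ⊔ ℓ₁)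
  IsQ G = IsMinimum (λ m → ∃[ A ] Realizes G A × IsQᴹ A m)

  Achievable : ∀ {n} → SimpleGraph n → ℕ → Set (c ⊔ ℓ₁)
  Achievable {n} G k =
    1 ℕ.≤ k × k ℕ.≤ ⌊ n /2⌋ ×
    ∃[ A ] Realizes G A × ∃[ e ] DistinctEigenvalues {m = 2} A e ×
      HasMultiplicity A (e zero) (n ∸ k) × HasMultiplicity A (e (suc zero)) k

  IsMB : ∀ {n} → SimpleGraph n → ℕ → Set (c ⊔ ℓ₁)
  IsMB G k = IsQ G 2 × IsMinimum (Achievable G) k

{-# OPTIONS --safe #-}

-- A rank-k orthogonal projection with the pattern of the complement of the path
-- is the Gram matrix of vectors v₁, …, vₙ in ℝᵏ with Σ vᵢ vᵢᵀ = I, consecutive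
-- vectors being orthogonal and all other pairs non-orthogonal.
--
-- Such vectors exist in ℝ³: start from six explicit vectors for which I is a
-- positive combination of the uᵢ uᵢᵀ and these matrices span the symmetric ones,
-- and repeatedly prepend u₁ × w for a generic w, giving it a small weight; by the
-- spanning property the old weights can be corrected and stay positive.  In the
-- plane they do not exist: v₁ and v₃ would be parallel, and v₃ ⊥ v₄ would force
-- v₁ ⊥ v₄.
--
-- A matrix with eigenvalues x and y of multiplicities n − k and k yields the
-- rank-k projection (A − x)/(y − x).  Finally, a symmetric matrix with at most one
-- eigenvalue is scalar: the supremum s of all t with t v·v ≤ v·Av is an eigenvalue,
-- since otherwise A − s would be positive definite and s could be increased; the
-- same applied to −A gives the largest eigenvalue.

module Submission where

open import Defs
open import Algebra.Bundles using (CommutativeRing)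
import Algebra.Properties.Ring
import Algebra.Properties.Semiring.Mult.TCOptimised
import Algebra.Properties.Semiring.Sum
import Algebra.Solver.Ring
open import Algebra.Solver.Ring.AlmostCommutativeRing using (fromCommutativeRing; _-Raw-AlmostCommutative⟶_)
open import Data.Fin.Base using (Fin; zero; suc; toℕ; punchIn; punchOut; join; splitAt; _↑ˡ_; _↑ʳ_)
import Data.Fin.Properties as Fin
open import Data.Integer.Base as ℤ using (ℤ; +_; -[1+_])
import Data.Integer.Properties as ℤ
open import Data.Maybe.Base using (Maybe; just; nothing)
open import Data.Nat.Base as ℕ using (ℕ; zero; suc; s<s)
import Data.Nat.Properties as ℕ
open import Data.Product.Base using (_×_; _,_; proj₁; proj₂; ∃; ∃-syntax)
open import Data.Sum.Base using (_⊎_; inj₁; inj₂; [_,_]′)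
open import Data.Vec.Base using ([]; _∷_; lookup; tabulate)
open import Data.Vec.Functional using (Vector; replicate; insertAt; _++_; foldr) renaming (_∷_ to _◂_)
import Data.Vec.Functional.Properties as Vector
import Data.Vec.Functional.Relation.Binary.Equality.Setoid as VectorEquality
open import Function.Base using (_∘_)
open import Function.Bundles using (mk⇔; Equivalence)
open import Level using (_⊔_; Lift; lift)
open import Relation.Binary.Definitions using (Tri; tri<; tri≈; tri>)
open import Relation.Binary.PropositionalEquality.Core as ≡ using (_≡_; _≢_)
open import Relation.Binary.Structures using (IsStrictTotalOrder)
open import Relation.Nullary.Decidable using (yes; no; ¬?; _→-dec_; from-yes)
open import Relation.Nullary.Negation using (¬_; contradiction)

-- The obstacle to prepending u₁ × w is that (u₁ × w) · uⱼ = w · (uⱼ × u₁): a suitable w exists only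
-- if no uⱼ is parallel to u₁. Hence this becomes an invariant, and to restore it w must also be
-- non-orthogonal to u₂. Six vectors are the natural start because the symmetric 3 × 3 matrices have
-- dimension six. The weighted sum of the uᵢ uᵢᵀ is only required to be a positive multiple of I, so
-- that the start is integral and every identity is polynomial; square roots enter once, at the very
-- end. The least eigenvalue is found without compactness of the sphere and without determinants: an
-- invertible positive semidefinite form is bounded below by t v·v with an explicit t > 0. This
-- argument yields an eigenvector only up to double negation, which is harmless because equality is
-- decidable.

-- The integers in a commutative ring, as coefficients for the ring solver

module IntegerCoefficients {c ℓ} (R : CommutativeRing c ℓ) where
  open CommutativeRing R
  open Algebra.Properties.Ring ring
  private module M = Algebra.Properties.Semiring.Mult.TCOptimised semiring
  open import Relation.Binary.Reasoning.Setoid setoid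

  -- With the optimised multiples, `ι (+ 0)` and `ι (+ 1)` compute to `0#` and `1#`, so `con (+ 0)`
  -- and `con (+ 1)` in solver equations denote these constants definitionally.
  ι : ℤ → Carrier
  ι (+ n)    = n M.× 1#
  ι -[1+ n ] = - (suc n M.× 1#)

  private
    cancelˡ : ∀ x y z → (x + y) - (x + z) ≈ y - z
    cancelˡ x y z = begin
      (x + y) - (x + z)       ≈⟨ +-congˡ (-‿anti-homo-+ x z) ⟩
      (x + y) + (- z - x)     ≈⟨ +-congʳ (+-comm x y) ⟩
      (y + x) + (- z - x)     ≈⟨ +-assoc y x _ ⟩
      y + (x + (- z - x))     ≈⟨ +-congˡ (+-congˡ (+-comm (- z) (- x))) ⟩
      y + (x + (- x - z))     ≈⟨ +-congˡ (+-assoc x (- x) (- z)) ⟨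
      y + ((x - x) - z)       ≈⟨ +-congˡ (+-congʳ (-‿inverseʳ x)) ⟩
      y + (0# - z)            ≈⟨ +-congˡ (+-identityˡ (- z)) ⟩
      y - z                   ∎

  ι-⊖ : ∀ m n → ι (m ℤ.⊖ n) ≈ m M.× 1# - n M.× 1#
  ι-⊖ zero    zero    = sym (-‿inverseʳ 0#)
  ι-⊖ zero    (suc n) = sym (+-identityˡ _)
  ι-⊖ (suc m) zero    = sym (trans (+-congˡ -0#≈0#) (+-identityʳ _))
  ι-⊖ (suc m) (suc n) = begin
    ι (suc m ℤ.⊖ suc n)                       ≡⟨ ≡.cong ι (ℤ.[1+m]⊖[1+n]≡m⊖n m n) ⟩
    ι (m ℤ.⊖ n)                               ≈⟨ ι-⊖ m n ⟩
    m M.× 1# - n M.× 1#                       ≈⟨ cancelˡ 1# _ _ ⟨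
    (1# + m M.× 1#) - (1# + n M.× 1#)         ≈⟨ +-cong (M.1+× m 1#) (-‿cong (M.1+× n 1#)) ⟨
    suc m M.× 1# - suc n M.× 1#               ∎

  ι-+ : ∀ i j → ι (i ℤ.+ j) ≈ ι i + ι j
  ι-+ (+ m)    (+ n)    = M.×-homo-+ 1# m n
  ι-+ (+ m)    -[1+ n ] = ι-⊖ m (suc n)
  ι-+ -[1+ m ] (+ n)    = trans (ι-⊖ n (suc m)) (+-comm _ _)
  ι-+ -[1+ m ] -[1+ n ] = begin
    - (suc (suc (m ℕ.+ n)) M.× 1#)       ≈⟨ -‿cong (M.1+× (suc (m ℕ.+ n)) 1#) ⟩
    - (1# + (suc m ℕ.+ n) M.× 1#)        ≈⟨ -‿cong (+-congˡ (M.×-homo-+ 1# (suc m) n)) ⟩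
    - (1# + (suc m M.× 1# + n M.× 1#))   ≈⟨ -‿cong (+-assoc _ _ _) ⟨
    - ((1# + suc m M.× 1#) + n M.× 1#)   ≈⟨ -‿cong (+-congʳ (+-comm _ _)) ⟩
    - ((suc m M.× 1# + 1#) + n M.× 1#)   ≈⟨ -‿cong (+-assoc _ _ _) ⟩
    - (suc m M.× 1# + (1# + n M.× 1#))   ≈⟨ -‿cong (+-congˡ (M.1+× n 1#)) ⟨
    - (suc m M.× 1# + suc n M.× 1#)      ≈⟨ trans (-‿anti-homo-+ _ _) (+-comm _ _) ⟩
    - (suc m M.× 1#) - suc n M.× 1#      ∎

  ι-neg : ∀ i → ι (ℤ.- i) ≈ - ι i
  ι-neg (+ zero)  = sym -0#≈0#
  ι-neg (+ suc n) = refl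
  ι-neg -[1+ n ]  = sym (-‿involutive _)

  ι-*⁺ : ∀ m n → ι (+ m ℤ.* + n) ≈ ι (+ m) * ι (+ n)
  ι-*⁺ m n = trans (reflexive (≡.cong ι (≡.sym (ℤ.pos-* m n)))) (M.×1-homo-* m n)

  ι-*ʳ : ∀ m j → ι (+ m ℤ.* j) ≈ ι (+ m) * ι j
  ι-*ʳ m (+ n)    = ι-*⁺ m n
  ι-*ʳ m -[1+ n ] = begin
    ι (+ m ℤ.* -[1+ n ])            ≡⟨ ≡.cong ι (ℤ.neg-distribʳ-* (+ m) (+ suc n)) ⟨
    ι (ℤ.- (+ m ℤ.* + suc n))       ≈⟨ ι-neg (+ m ℤ.* + suc n) ⟩
    - ι (+ m ℤ.* + suc n)           ≈⟨ -‿cong (ι-*⁺ m (suc n)) ⟩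
    - (ι (+ m) * ι (+ suc n))       ≈⟨ -‿distribʳ-* _ _ ⟩
    ι (+ m) * ι -[1+ n ]            ∎

  ι-* : ∀ i j → ι (i ℤ.* j) ≈ ι i * ι j
  ι-* (+ m)    j = ι-*ʳ m j
  ι-* -[1+ m ] j = begin
    ι (-[1+ m ] ℤ.* j)          ≡⟨ ≡.cong ι (ℤ.neg-distribˡ-* (+ suc m) j) ⟨
    ι (ℤ.- (+ suc m ℤ.* j))     ≈⟨ ι-neg (+ suc m ℤ.* j) ⟩
    - ι (+ suc m ℤ.* j)         ≈⟨ -‿cong (ι-*ʳ (suc m) j) ⟩
    - (ι (+ suc m) * ι j)       ≈⟨ -‿distribˡ-* _ _ ⟩
    ι -[1+ m ] * ι j            ∎

  private
    homomorphism : ℤ.+-*-rawRing -Raw-AlmostCommutative⟶ fromCommutativeRing R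
    homomorphism = record
      { ⟦_⟧ = ι ; +-homo = ι-+ ; *-homo = ι-* ; -‿homo = ι-neg ; 0-homo = refl ; 1-homo = refl }

    _coeff≟_ : ∀ i j → Maybe (ι i ≈ ι j)
    i coeff≟ j with i ℤ.≟ j
    ... | yes ≡.refl = just refl
    ... | no  _      = nothing

  module Solver = Algebra.Solver.Ring ℤ.+-*-rawRing (fromCommutativeRing R) homomorphism _coeff≟_

-- Ordered field arithmetic and square roots

module OrderedField {c ℓ₁ ℓ₂} (ℝ : RealNumbers c ℓ₁ ℓ₂) where
  open RealNumbers ℝ public
  open CommutativeRing commutativeRing public
    using (refl; sym; trans; reflexive; setoid; _-_; ring; semiring
          ; +-cong; +-congˡ; +-congʳ; *-cong; *-congˡ; *-congʳ; -‿cong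
          ; +-identityˡ; +-identityʳ; *-identityˡ; *-identityʳ; zeroˡ; zeroʳ
          ; +-comm; *-comm; +-assoc; *-assoc; distribˡ; -‿inverseʳ)
  open Algebra.Properties.Ring ring public
    using (-0#≈0#; x∙y⁻¹≈ε⇒x≈y; x≈y⇒x∙y⁻¹≈ε)
  open IsStrictTotalOrder isStrictTotalOrder public
    using (compare; _≟_; irrefl; <-respˡ-≈; <-respʳ-≈)
    renaming (trans to <-trans)
  open IntegerCoefficients commutativeRing public
  open Solver public using (solve; prove; _:=_; con; var; _:+_; _:*_; _:-_; :-_; Polynomial; ⟦_⟧)

  open import Relation.Binary.Reasoning.Setoid setoid

  _≉_ : Carrier → Carrier → Set ℓ₁
  x ≉ y = ¬ (x ≈ y)

  infix 4 _≉_

  inverse : ∀ {x} → x ≉ 0# → ∃[ y ] x * y ≈ 1#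
  inverse x≉0 = let y , _ , xy≈1 = ≉0⇒invertible _ x≉0 in y , xy≈1

  *-cancelˡ-0 : ∀ {x y} → x ≉ 0# → x * y ≈ 0# → y ≈ 0#
  *-cancelˡ-0 {x} {y} x≉0 xy≈0 with inverse x≉0
  ... | z , xz≈1 = begin
    y             ≈⟨ *-identityˡ y ⟨
    1# * y        ≈⟨ *-congʳ xz≈1 ⟨
    x * z * y     ≈⟨ solve 3 (λ x y z → x :* z :* y := z :* (x :* y)) refl x y z ⟩
    z * (x * y)   ≈⟨ *-congˡ xy≈0 ⟩
    z * 0#        ≈⟨ zeroʳ z ⟩
    0#            ∎

  *-≉0 : ∀ {x y} → x ≉ 0# → y ≉ 0# → x * y ≉ 0#
  *-≉0 x≉0 y≉0 xy≈0 = y≉0 (*-cancelˡ-0 x≉0 xy≈0)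

  -- Trichotomy decides equality. This permits proving equations by contradiction, in particular
  -- from an eigenvector that exists only up to double negation.
  ≈-stable : ∀ {x y} → ¬ (x ≉ y) → x ≈ y
  ≈-stable {x} {y} ¬¬x≈y with x ≟ y
  ... | yes x≈y = x≈y
  ... | no  x≉y = contradiction x≉y ¬¬x≈y

  ≤-refl : ∀ {x} → x ≤ x
  ≤-refl = inj₂ refl

  <⇒≱ : ∀ {x y} → x < y → ¬ (y ≤ x)
  <⇒≱ x<y (inj₁ y<x) = irrefl refl (<-trans x<y y<x)
  <⇒≱ x<y (inj₂ y≈x) = irrefl (sym y≈x) x<y

  ≮⇒≥ : ∀ {x y} → ¬ (x < y) → y ≤ x
  ≮⇒≥ {x} {y} x≮y with compare x y
  ... | tri< x<y _ _ = contradiction x<y x≮y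
  ... | tri≈ _ x≈y _ = inj₂ (sym x≈y)
  ... | tri> _ _ y<x = inj₁ y<x

  ≤-antisym : ∀ {x y} → x ≤ y → y ≤ x → x ≈ y
  ≤-antisym (inj₁ x<y) y≤x = contradiction y≤x (<⇒≱ x<y)
  ≤-antisym (inj₂ x≈y) _   = x≈y

  >⇒≉ : ∀ {x} → 0# < x → x ≉ 0#
  >⇒≉ 0<x x≈0 = irrefl (sym x≈0) 0<x

  <⇒0<- : ∀ {x y} → x < y → 0# < y - x
  <⇒0<- {x} x<y = <-respˡ-≈ (-‿inverseʳ x) (+-monoˡ-< (- x) x<y)

  0<-⇒< : ∀ {x y} → 0# < y - x → x < y
  0<-⇒< {x} {y} 0<y-x = <-respˡ-≈ (+-identityˡ x)
    (<-respʳ-≈ (solve 2 (λ x y → y :- x :+ x := y) refl x y) (+-monoˡ-< x 0<y-x))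

  ≤⇒0≤- : ∀ {x y} → x ≤ y → 0# ≤ y - x
  ≤⇒0≤- (inj₁ x<y) = inj₁ (<⇒0<- x<y)
  ≤⇒0≤- (inj₂ x≈y) = inj₂ (sym (x≈y⇒x∙y⁻¹≈ε (sym x≈y)))

  0≤-⇒≤ : ∀ {x y} → 0# ≤ y - x → x ≤ y
  0≤-⇒≤ (inj₁ 0<) = inj₁ (0<-⇒< 0<)
  0≤-⇒≤ (inj₂ 0≈) = inj₂ (sym (x∙y⁻¹≈ε⇒x≈y _ _ (sym 0≈)))

  ≤-respʳ-≈ : ∀ {x y z} → y ≈ z → x ≤ y → x ≤ z
  ≤-respʳ-≈ y≈z (inj₁ x<y) = inj₁ (<-respʳ-≈ y≈z x<y)
  ≤-respʳ-≈ y≈z (inj₂ x≈y) = inj₂ (trans x≈y y≈z)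

  0<+ : ∀ {x y} → 0# < x → 0# < y → 0# < x + y
  0<+ {x} {y} 0<x 0<y = <-trans 0<y (<-respˡ-≈ (+-identityˡ y) (+-monoˡ-< y 0<x))

  0<+≤ : ∀ {x y} → 0# < x → 0# ≤ y → 0# < x + y
  0<+≤ 0<x (inj₁ 0<y) = 0<+ 0<x 0<y
  0<+≤ {x} 0<x (inj₂ 0≈y) = <-respʳ-≈ (trans (sym (+-identityʳ x)) (+-congˡ 0≈y)) 0<x

  0≤+ : ∀ {x y} → 0# ≤ x → 0# ≤ y → 0# ≤ x + y
  0≤+ (inj₁ 0<x) 0≤y = inj₁ (0<+≤ 0<x 0≤y)
  0≤+ {x} {y} (inj₂ 0≈x) 0≤y = ≤-respʳ-≈ (trans (sym (+-identityˡ y)) (+-congʳ 0≈x)) 0≤y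

  0≤* : ∀ {x y} → 0# ≤ x → 0# ≤ y → 0# ≤ x * y
  0≤* (inj₁ 0<x) (inj₁ 0<y) = inj₁ (*-pos 0<x 0<y)
  0≤* {x} _ (inj₂ 0≈y) = inj₂ (trans (sym (zeroʳ x)) (*-congˡ 0≈y))
  0≤* {y = y} (inj₂ 0≈x) _ = inj₂ (trans (sym (zeroˡ y)) (*-congʳ 0≈x))

  neg-pos : ∀ {x} → x < 0# → 0# < - x
  neg-pos {x} x<0 = <-respʳ-≈ (+-identityˡ (- x)) (<⇒0<- x<0)

  0≤x² : ∀ x → 0# ≤ x * x
  0≤x² x with compare x 0#
  ... | tri< x<0 _ _ = inj₁ (<-respʳ-≈ (solve 1 (λ x → :- x :* :- x := x :* x) refl x)
                               (*-pos (neg-pos x<0) (neg-pos x<0)))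
  ... | tri≈ _ x≈0 _ = inj₂ (sym (trans (*-congʳ x≈0) (zeroˡ x)))
  ... | tri> _ _ 0<x = inj₁ (*-pos 0<x 0<x)

  0<x² : ∀ {x} → x ≉ 0# → 0# < x * x
  0<x² {x} x≉0 with 0≤x² x
  ... | inj₁ 0<x² = 0<x²
  ... | inj₂ 0≈x² = contradiction (sym 0≈x²) (*-≉0 x≉0 x≉0)

  0<1 : 0# < 1#
  0<1 = <-respʳ-≈ (*-identityˡ 1#) (0<x² (λ 1≈0 → 0≉1 (sym 1≈0)))

  inverse-pos : ∀ {x} → 0# < x → ∃[ y ] 0# < y × x * y ≈ 1#
  inverse-pos {x} 0<x with inverse (>⇒≉ 0<x)
  ... | y , xy≈1 with compare y 0#
  ...   | tri> _ _ 0<y = y , 0<y , xy≈1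
  ...   | tri≈ _ y≈0 _ = contradiction (trans (sym (trans (*-congˡ y≈0) (zeroʳ x))) xy≈1) 0≉1
  ...   | tri< y<0 _ _ = contradiction (inj₁ 0<1)
    (<⇒≱ (0<-⇒< (<-respʳ-≈ x*-y≈0-1 (*-pos 0<x (neg-pos y<0)))))
    where
    x*-y≈0-1 : x * - y ≈ 0# - 1#
    x*-y≈0-1 = trans (solve 2 (λ x y → x :* :- y := con (+ 0) :- x :* y) refl x y)
                     (+-congˡ (-‿cong xy≈1))

  halve-nonneg : ∀ {x} → 0# ≤ x + x → 0# ≤ x
  halve-nonneg {x} 0≤2x = ≮⇒≥ λ x<0 → <⇒≱
    (0<-⇒< (<-respʳ-≈ (solve 1 (λ x → :- x :+ :- x := con (+ 0) :- (x :+ x)) refl x)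
      (0<+ (neg-pos x<0) (neg-pos x<0)))) 0≤2x

  0<ι : ∀ n → 0# < ι (+ suc n)
  0<ι zero    = 0<1
  0<ι (suc n) = 0<+ (0<ι n) 0<1

  ι-≉0 : ∀ {i} → i ≢ + 0 → ι i ≉ 0#
  ι-≉0 {+ zero}   i≢0 = contradiction ≡.refl i≢0
  ι-≉0 {+ suc n}  _   = >⇒≉ (0<ι n)
  ι-≉0 { -[1+ n ]} _  -x≈0 = >⇒≉ (0<ι n)
    (trans (solve 1 (λ x → x := :- :- x) refl _) (trans (-‿cong -x≈0) -0#≈0#))

  *-mono-< : ∀ {x y z} → 0# < z → x < y → z * x < z * y
  *-mono-< {x} {y} {z} 0<z x<y =
    0<-⇒< (<-respʳ-≈ (solve 3 (λ x y z → z :* (y :- x) := z :* y :- z :* x) refl x y z)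
      (*-pos 0<z (<⇒0<- x<y)))

  private
    -- `d` stands for the inverse of C + s. Keeping it as a variable, subject to (C + s) d ≈ 1,
    -- brings the two identities below within reach of a ring solver.
    improve : (C a s d : Carrier) → Carrier
    improve C a s d = (C * s + a) * d

    improve-diff : ∀ C a s d → (C + s) * d ≈ 1# → improve C a s d - s ≈ d * (a - s * s)
    improve-diff C a s d eq = begin
      (C * s + a) * d - s
        ≈⟨ +-congˡ (-‿cong (trans (*-congˡ eq) (*-identityʳ s))) ⟨
      (C * s + a) * d - s * ((C + s) * d)
        ≈⟨ solve 4 (λ C a s d → (C :* s :+ a) :* d :- s :* ((C :+ s) :* d)
                             := d :* (a :- s :* s)) refl C a s d ⟩
      d * (a - s * s)
        ∎

    -- With u = C + s and v = C s + a, the difference a u² - v² factors as (C² - a)(a - s²).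
    improve² : ∀ C a s d → (C + s) * d ≈ 1# →
               a - improve C a s d * improve C a s d ≈ (C * C - a) * (d * d) * (a - s * s)
    improve² C a s d eq = begin
      a - v * d * (v * d)
        ≈⟨ +-congʳ (trans (*-congˡ (trans (*-cong eq eq) (*-identityʳ 1#))) (*-identityʳ a)) ⟨
      a * (u * d * (u * d)) - v * d * (v * d)
        ≈⟨ solve 4 (λ a u v d → a :* (u :* d :* (u :* d)) :- v :* d :* (v :* d)
                             := (a :* (u :* u) :- v :* v) :* (d :* d)) refl a u v d ⟩
      (a * (u * u) - v * v) * (d * d)
        ≈⟨ *-congʳ (solve 3 (λ C s a →
             a :* ((C :+ s) :* (C :+ s)) :- (C :* s :+ a) :* (C :* s :+ a)
               := (C :* C :- a) :* (a :- s :* s)) refl C s a) ⟩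
      (C * C - a) * (a - s * s) * (d * d)
        ≈⟨ solve 3 (λ x y z → x :* y :* z := x :* z :* y) refl (C * C - a) (a - s * s) (d * d) ⟩
      (C * C - a) * (d * d) * (a - s * s)
        ∎
      where
      u = C + s
      v = C * s + a

    flip-difference : ∀ {y z e v w} → y - z ≈ e * (v - w) → e * (w - v) ≈ z - y
    flip-difference {y} {z} {e} {v} {w} eq = begin
      e * (w - v)     ≈⟨ solve 3 (λ e v w → e :* (w :- v) := :- (e :* (v :- w))) refl e v w ⟩
      - (e * (v - w)) ≈⟨ -‿cong eq ⟨
      - (y - z)       ≈⟨ solve 2 (λ y z → :- (y :- z) := z :- y) refl y z ⟩
      z - y           ∎

    root-bound : ∀ {a x y} → 0# < y → x * x ≤ a → a < y * y → x ≤ y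
    root-bound 0<y x²≤a a<y² = ≮⇒≥ λ y<x → <⇒≱
      (<-trans a<y² (<-trans (*-mono-< 0<y y<x)
        (<-respˡ-≈ (*-comm _ _) (*-mono-< (<-trans 0<y y<x) y<x)))) x²≤a

    -- The map s ↦ (C s + a) / (C + s) moves every s towards √a, and C² > a
    -- guarantees that it does not jump over √a.
    supremum-is-root : ∀ {a s} C → 0# < a → 0# < C → a < C * C →
                       (∀ x → x * x ≤ a → x ≤ s) →
                       (∀ b → (∀ x → x * x ≤ a → x ≤ b) → s ≤ b) →
                       s * s ≈ a
    supremum-is-root {a} {s} C 0<a 0<C a<C² upper least = go (compare (s * s) a)
      where
      0≤s : 0# ≤ s
      0≤s = upper 0# (inj₁ (<-respˡ-≈ (sym (zeroˡ 0#)) 0<a))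

      go : Tri (s * s < a) (s * s ≈ a) (a < s * s) → s * s ≈ a
      go tri with inverse-pos (0<+≤ 0<C 0≤s)
      ... | d , 0<d , eq = case tri
        where
        y : Carrier
        y = improve C a s d

        0<y : 0# < y
        0<y = *-pos (<-respʳ-≈ (+-comm _ _) (0<+≤ 0<a (0≤* (inj₁ 0<C) 0≤s))) 0<d

        0<E : 0# < (C * C - a) * (d * d)
        0<E = *-pos (<⇒0<- a<C²) (*-pos 0<d 0<d)

        case : Tri (s * s < a) (s * s ≈ a) (a < s * s) → s * s ≈ a
        case (tri≈ _ s²≈a _) = s²≈a
        case (tri< s²<a _ _) = contradiction (upper y (inj₁ y²<a)) (<⇒≱ s<y)
          where
          y²<a : y * y < a
          y²<a = 0<-⇒< (<-respʳ-≈ (sym (improve² C a s d eq)) (*-pos 0<E (<⇒0<- s²<a)))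
          s<y : s < y
          s<y = 0<-⇒< (<-respʳ-≈ (sym (improve-diff C a s d eq)) (*-pos 0<d (<⇒0<- s²<a)))
        case (tri> _ _ a<s²) =
          contradiction (least y (λ x x²≤a → root-bound 0<y x²≤a a<y²)) (<⇒≱ y<s)
          where
          a<y² : a < y * y
          a<y² = 0<-⇒< (<-respʳ-≈ (flip-difference (improve² C a s d eq))
                          (*-pos 0<E (<⇒0<- a<s²)))
          y<s : y < s
          y<s = 0<-⇒< (<-respʳ-≈ (flip-difference (improve-diff C a s d eq))
                         (*-pos 0<d (<⇒0<- a<s²)))

  sqrt : ∀ {a} → 0# < a → ∃[ r ] r * r ≈ a
  sqrt {a} 0<a = s , supremum-is-root C 0<a 0<C a<C²
      (λ x x²≤a → upper x (lift x²≤a)) (λ b ub → least b (λ x (lift x²≤a) → ub x x²≤a))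
    where
    C : Carrier
    -- C² - a = 1 + a + a² is positive for small and large a alike, so this C is both an upper bound
    -- of the set and an admissible parameter of the map.
    C = 1# + a

    0<C : 0# < C
    0<C = 0<+ 0<1 0<a

    a<C² : a < C * C
    a<C² = 0<-⇒< (<-respʳ-≈
      (solve 1 (λ a → con (+ 1) :+ a :+ a :* a := (con (+ 1) :+ a) :* (con (+ 1) :+ a) :- a) refl a)
      (0<+ 0<C (*-pos 0<a 0<a)))

    supremum = complete (λ x → Lift (c ⊔ ℓ₁ ⊔ ℓ₂) (x * x ≤ a))
      (0# , lift (inj₁ (<-respˡ-≈ (sym (zeroˡ 0#)) 0<a)))
      (C , λ x (lift x²≤a) → root-bound 0<C x²≤a a<C²)

    s     = proj₁ supremum
    upper = proj₁ (proj₂ supremum)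
    least = proj₂ (proj₂ supremum)

-- Linear systems, bases and eigenspaces

module LinearAlgebra {c ℓ₁ ℓ₂} (ℝ : RealNumbers c ℓ₁ ℓ₂) where
  open OrderedField ℝ
  open Algebra.Properties.Semiring.Sum semiring public
    using (sum; sum-syntax; sum-cong-≋; sum-remove; ∑-distrib-+; ∑-comm; *-distribˡ-sum; *-distribʳ-sum)
  open VectorEquality setoid public using (_≋_; ≋-refl; ≋-sym)
  open import Relation.Binary.Reasoning.Setoid setoid

  IsZero : ∀ {n} → Vector Carrier n → Set ℓ₁
  IsZero x = ∀ i → x i ≈ 0#

  sum-zero : ∀ {n} {x : Vector Carrier n} → IsZero x → sum x ≈ 0#
  sum-zero {zero}  x≈0 = refl
  sum-zero {suc n} x≈0 = trans (+-cong (x≈0 zero) (sum-zero (x≈0 ∘ suc))) (+-identityˡ 0#)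

  sum-linear : ∀ {n} a b (x y : Vector Carrier n) →
               ∑[ i < n ] (a * x i + b * y i) ≈ a * sum x + b * sum y
  sum-linear a b x y = trans (∑-distrib-+ (λ i → a * x i) (λ i → b * y i))
    (sym (+-cong (*-distribˡ-sum a x) (*-distribˡ-sum b y)))

  sum-neg : ∀ {n} (x : Vector Carrier n) → ∑[ i < n ] (- x i) ≈ - sum x
  sum-neg {zero}  x = sym -0#≈0#
  sum-neg {suc n} x = trans (+-congˡ (sum-neg (x ∘ suc)))
    (solve 2 (λ a b → :- a :+ :- b := :- (a :+ b)) refl (x zero) (sum (x ∘ suc)))

  sum-splitAt : ∀ m {n} (x : Vector Carrier (m ℕ.+ n)) →
                sum x ≈ ∑[ i < m ] x (i ↑ˡ n) + ∑[ j < n ] x (m ↑ʳ j)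
  sum-splitAt zero    x = sym (+-identityˡ _)
  sum-splitAt (suc m) x = trans (+-congˡ (sum-splitAt m (x ∘ suc))) (sym (+-assoc _ _ _))

  -- Serves as the standard basis and, read with both indices, as the identity matrix.
  unit : ∀ {n} → Fin n → Vector Carrier n
  unit zero    zero    = 1#
  unit zero    (suc j) = 0#
  unit (suc i) zero    = 0#
  unit (suc i) (suc j) = unit i j

  unit-sym : ∀ {n} (i j : Fin n) → unit i j ≈ unit j i
  unit-sym zero    zero    = refl
  unit-sym zero    (suc j) = refl
  unit-sym (suc i) zero    = refl
  unit-sym (suc i) (suc j) = unit-sym i j

  sum-unit : ∀ {n} (x : Vector Carrier n) i → ∑[ j < n ] (x j * unit i j) ≈ x i
  sum-unit x zero    = trans (+-cong (*-identityʳ _) (sum-zero (λ j → zeroʳ (x (suc j))))) (+-identityʳ _)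
  sum-unit x (suc i) = trans (+-cong (zeroʳ _) (sum-unit (x ∘ suc) i)) (+-identityˡ _)

  unit-≉0 : ∀ {n} (i : Fin n) → ¬ IsZero (unit i)
  unit-≉0 zero    z = 0≉1 (sym (z zero))
  unit-≉0 (suc i) z = unit-≉0 i (z ∘ suc)

  dot : ∀ {n} → Vector Carrier n → Vector Carrier n → Carrier
  dot x y = sum (λ i → x i * y i)

  dot-cong : ∀ {n} {x x′ y y′ : Vector Carrier n} → x ≋ x′ → y ≋ y′ → dot x y ≈ dot x′ y′
  dot-cong x≋x′ y≋y′ = sum-cong-≋ (λ i → *-cong (x≋x′ i) (y≋y′ i))

  dot-comm : ∀ {n} (x y : Vector Carrier n) → dot x y ≈ dot y x
  dot-comm x y = sum-cong-≋ (λ i → *-comm (x i) (y i))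

  dot-linearʳ : ∀ {n} (x : Vector Carrier n) a b y z →
                dot x (λ i → a * y i + b * z i) ≈ a * dot x y + b * dot x z
  dot-linearʳ x a b y z = trans
    (sum-cong-≋ (λ i → solve 5 (λ x a b y z → x :* (a :* y :+ b :* z) := a :* (x :* y) :+ b :* (x :* z))
                              refl (x i) a b (y i) (z i)))
    (sum-linear a b (λ i → x i * y i) (λ i → x i * z i))

  dot-combination : ∀ {n k} (x : Vector Carrier n) (a : Vector Carrier k) b →
                    dot x (combination ℝ a b) ≈ ∑[ j < k ] (a j * dot x (b j))
  dot-combination x a b = begin
    sum (λ i → x i * sum (λ j → a j * b j i))     ≈⟨ sum-cong-≋ (λ i → *-distribˡ-sum (x i) (λ j → a j * b j i)) ⟩
    sum (λ i → sum (λ j → x i * (a j * b j i)))   ≈⟨ ∑-comm (λ i j → x i * (a j * b j i)) ⟩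
    sum (λ j → sum (λ i → x i * (a j * b j i)))   ≈⟨ sum-cong-≋ (λ j → sum-cong-≋ (λ i →
                                                       solve 3 (λ x a b → x :* (a :* b) := a :* (x :* b)) refl (x i) (a j) (b j i))) ⟩
    sum (λ j → sum (λ i → a j * (x i * b j i)))   ≈⟨ sum-cong-≋ (λ j → *-distribˡ-sum (a j) (λ i → x i * b j i)) ⟨
    sum (λ j → a j * sum (λ i → x i * b j i))     ∎

  combination-cong : ∀ {n k} {a a′ : Vector Carrier k} {b b′ : Vector (Vector Carrier n) k} →
                     a ≋ a′ → (∀ j → b j ≋ b′ j) → combination ℝ a b ≋ combination ℝ a′ b′
  combination-cong a≋a′ b≋b′ i = sum-cong-≋ (λ j → *-cong (a≋a′ j) (b≋b′ j i))

  -- Associativity of a triple matrix product in disguise. Taking the vectors of `b` constant or of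
  -- length one yields the versions for `mulVec` and for bilinear forms.
  combination-assoc : ∀ {n k m} (x : Vector Carrier m) (a : Fin m → Vector Carrier k)
                      (b : Vector (Vector Carrier n) k) →
                      combination ℝ x (λ i → combination ℝ (a i) b) ≋ combination ℝ (combination ℝ x a) b
  combination-assoc x a b l = begin
    sum (λ i → x i * sum (λ j → a i j * b j l))     ≈⟨ sum-cong-≋ (λ i → *-distribˡ-sum (x i) (λ j → a i j * b j l)) ⟩
    sum (λ i → sum (λ j → x i * (a i j * b j l)))   ≈⟨ ∑-comm (λ i j → x i * (a i j * b j l)) ⟩
    sum (λ j → sum (λ i → x i * (a i j * b j l)))   ≈⟨ sum-cong-≋ (λ j → sum-cong-≋ (λ i → sym (*-assoc (x i) (a i j) (b j l)))) ⟩
    sum (λ j → sum (λ i → x i * a i j * b j l))     ≈⟨ sum-cong-≋ (λ j → *-distribʳ-sum (b j l) (λ i → x i * a i j)) ⟨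
    sum (λ j → sum (λ i → x i * a i j) * b j l)     ∎

  mulVec-cong : ∀ {n} (A : Matrix ℝ n) {x y} → x ≋ y → mulVec ℝ A x ≋ mulVec ℝ A y
  mulVec-cong A x≋y i = dot-cong {x = A i} ≋-refl x≋y

  mulVec-unit : ∀ {n} (A : Matrix ℝ n) j i → mulVec ℝ A (unit j) i ≈ A i j
  mulVec-unit A j i = sum-unit (A i) j

  mulVec-assoc : ∀ {n} (A B : Matrix ℝ n) x → mulVec ℝ A (mulVec ℝ B x) ≋ mulVec ℝ (mulMat ℝ A B) x
  mulVec-assoc A B x i = combination-assoc (A i) B (λ j _ → x j) i

  eigenspace-combination : ∀ {n k} (A : Matrix ℝ n) x (a : Vector Carrier k) {b} →
                           (∀ j → Eigenspace ℝ A x (b j)) → Eigenspace ℝ A x (combination ℝ a b)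
  eigenspace-combination A x a {b} eig i = begin
    mulVec ℝ A (combination ℝ a b) i           ≈⟨ dot-combination (A i) a b ⟩
    sum (λ j → a j * mulVec ℝ A (b j) i)       ≈⟨ sum-cong-≋ (λ j → trans (*-congˡ (eig j i))
                                                   (solve 3 (λ a x b → a :* (x :* b) := x :* (a :* b)) refl (a j) x (b j i))) ⟩
    sum (λ j → x * (a j * b j i))              ≈⟨ *-distribˡ-sum x (λ j → a j * b j i) ⟨
    x * combination ℝ a b i                    ∎

  eigenspace-linear : ∀ {n} (A : Matrix ℝ n) x a b {y z} → Eigenspace ℝ A x y → Eigenspace ℝ A x z →
                      Eigenspace ℝ A x (λ i → a * y i + b * z i)
  eigenspace-linear A x a b {y} {z} ey ez i = begin
    mulVec ℝ A (λ i → a * y i + b * z i) i         ≈⟨ dot-linearʳ (A i) a b y z ⟩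
    a * mulVec ℝ A y i + b * mulVec ℝ A z i        ≈⟨ +-cong (*-congˡ (ey i)) (*-congˡ (ez i)) ⟩
    a * (x * y i) + b * (x * z i)                  ≈⟨ solve 5 (λ a b x y z → a :* (x :* y) :+ b :* (x :* z) := x :* (a :* y :+ b :* z))
                                                        refl a b x (y i) (z i) ⟩
    x * (a * y i + b * z i)                        ∎

  eigenspace-cong : ∀ {n} (A : Matrix ℝ n) x {y z} → y ≋ z → Eigenspace ℝ A x y → Eigenspace ℝ A x z
  eigenspace-cong A x y≋z ey i = trans (mulVec-cong A (≋-sym y≋z) i) (trans (ey i) (*-congˡ (y≋z i)))

  eigenspaces-independent : ∀ {n} (A : Matrix ℝ n) {x y v} → x ≉ y →
                            Eigenspace ℝ A x v → Eigenspace ℝ A y v → IsZero v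
  eigenspaces-independent A {x} {y} {v} x≉y ex ey i = *-cancelˡ-0
    (λ x-y≈0 → x≉y (x∙y⁻¹≈ε⇒x≈y x y x-y≈0))
    (trans (solve 3 (λ x y v → (x :- y) :* v := x :* v :- y :* v) refl x y (v i))
           (x≈y⇒x∙y⁻¹≈ε (trans (sym (ex i)) (ey i))))

  -- Division-free elimination of the first unknown by means of equation p.
  private
    eliminate : ∀ {n} c d (a b y : Vector Carrier n) →
                d * (- sum (λ j → a j * y j)) + sum (λ j → b j * (c * y j)) ≈
                sum (λ j → (c * b j - d * a j) * y j)
    eliminate {zero}  c d a b y = trans (+-identityʳ _) (trans (*-congˡ -0#≈0#) (zeroʳ d))
    eliminate {suc n} c d a b y = trans
      (solve 7 (λ c d a b y s t →
          d :* (:- (a :* y :+ s)) :+ (b :* (c :* y) :+ t) := (c :* b :- d :* a) :* y :+ (d :* (:- s) :+ t))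
        refl c d (a zero) (b zero) (y zero) _ _)
      (+-congˡ (eliminate c d (a ∘ suc) (b ∘ suc) (y ∘ suc)))

  -- Gaussian elimination by induction on the number of equations. Linear dependence, surjectivity
  -- of injective matrices and spanning by eigenspaces are all derived from it.
  underdetermined : ∀ {m n} → m ℕ.< n → (M : Fin m → Fin n → Carrier) →
                    ∃[ x ] ¬ IsZero x × (∀ i → dot (M i) x ≈ 0#)
  underdetermined {zero}  {suc n} _ M = unit zero , unit-≉0 zero , λ ()
  underdetermined {suc m} {suc n} (s<s m<n) M
    with Fin.any? (λ i → ¬? (M i zero ≟ 0#))
  ... | no  none    = unit zero , unit-≉0 zero , λ i →
    trans (sum-unit (M i) zero) (≈-stable (λ ≉0 → none (i , ≉0)))
  ... | yes (p , pivot)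
    with underdetermined m<n (λ i j → M p zero * M (punchIn p i) (suc j) - M (punchIn p i) zero * M p (suc j))
  ... | y , y≉0 , solves = x , (λ x≈0 → y≉0 (λ j → *-cancelˡ-0 pivot (x≈0 (suc j)))) , row
    where
    -- The solution `y` of the reduced system is multiplied by the pivot, which spares a division in
    -- the first coordinate; as the pivot is nonzero, `x` is nonzero along with `y`.
    x : Vector Carrier (suc n)
    x = (- sum (λ j → M p (suc j) * y j)) ◂ (λ j → M p zero * y j)

    row : ∀ i → dot (M i) x ≈ 0#
    row i = trans (eliminate (M p zero) (M i zero) (M p ∘ suc) (M i ∘ suc) y) reduced
      where
      reduced : sum (λ j → (M p zero * M i (suc j) - M i zero * M p (suc j)) * y j) ≈ 0#
      reduced with p Fin.≟ i
      ... | yes ≡.refl = sum-zero (λ j → trans (*-congʳ (-‿inverseʳ _)) (zeroˡ (y j)))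
      ... | no  p≢i    = ≡.subst (λ i → sum (λ j → (M p zero * M i (suc j) - M i zero * M p (suc j)) * y j) ≈ 0#)
                           (Fin.punchIn-punchOut p≢i) (solves (punchOut p≢i))

  -- A kernel vector of the k × m matrix of coefficients is the desired relation.
  too-many-vectors : ∀ {n k m} → k ℕ.< m → (b : Vector (Vector Carrier n) k) (v : Vector (Vector Carrier n) m) →
                     (∀ i → ∃[ a ] v i ≋ combination ℝ a b) →
                     ∃[ x ] ¬ IsZero x × IsZero (combination ℝ x v)
  too-many-vectors k<m b v spans with underdetermined k<m (λ j i → proj₁ (spans i) j)
  ... | x , x≉0 , solves = x , x≉0 , λ l → begin
    combination ℝ x v l                                             ≈⟨ combination-cong {a = x} ≋-refl (λ i → proj₂ (spans i)) l ⟩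
    combination ℝ x (λ i → combination ℝ (proj₁ (spans i)) b) l     ≈⟨ combination-assoc x (λ i → proj₁ (spans i)) b l ⟩
    combination ℝ (combination ℝ x (λ i → proj₁ (spans i))) b l     ≈⟨ sum-zero (λ j → trans
      (*-congʳ (trans (dot-comm x (λ i → proj₁ (spans i) j)) (solves j))) (zeroˡ (b j l))) ⟩
    0#                                                              ∎

  private
    solve-for : ∀ {t s y z} → t * s ≈ 1# → y * t + z ≈ 0# → y ≈ - s * z
    solve-for {t} {s} {y} {z} ts≈1 eq = begin
      y                         ≈⟨ *-identityʳ y ⟨
      y * 1#                    ≈⟨ *-congˡ ts≈1 ⟨
      y * (t * s)               ≈⟨ solve 4 (λ y t s z → y :* (t :* s) := (y :* t :+ z) :* s :+ (:- s) :* z) refl y t s z ⟩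
      (y * t + z) * s + - s * z ≈⟨ +-congʳ (trans (*-congʳ eq) (zeroˡ s)) ⟩
      0# + - s * z              ≈⟨ +-identityˡ _ ⟩
      - s * z                   ∎

  -- The augmented system [y | B] has n equations in n + 1 unknowns, hence a nontrivial solution.
  -- Its coefficient at y cannot vanish, as B would then kill a nonzero vector; dividing by it gives
  -- the preimage.
  injective⇒surjective : ∀ {n} (B : Matrix ℝ n) → (∀ x → IsZero (mulVec ℝ B x) → IsZero x) →
                         ∀ y → ∃[ x ] mulVec ℝ B x ≋ y
  injective⇒surjective {n} B injective y with underdetermined (ℕ.n<1+n n) (λ i → y i ◂ B i)
  ... | x , x≉0 , solves with x zero ≟ 0#
  ...   | yes x₀≈0 = contradiction x≈0 x≉0
    where
    x≈0 : IsZero x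
    x≈0 zero    = x₀≈0
    x≈0 (suc j) = injective (x ∘ suc)
      (λ i → trans (sym (trans (+-congʳ (trans (*-congˡ x₀≈0) (zeroʳ (y i)))) (+-identityˡ _))) (solves i)) j
  ...   | no  x₀≉0 = let s , x₀s≈1 = inverse x₀≉0 in
    (λ j → - s * x (suc j)) , λ i → begin
      sum (λ j → B i j * (- s * x (suc j)))      ≈⟨ sum-cong-≋ (λ j → solve 3 (λ b s x → b :* (s :* x) := s :* (b :* x))
                                                      refl (B i j) (- s) (x (suc j))) ⟩
      sum (λ j → - s * (B i j * x (suc j)))      ≈⟨ *-distribˡ-sum (- s) (λ j → B i j * x (suc j)) ⟨
      - s * sum (λ j → B i j * x (suc j))        ≈⟨ solve-for x₀s≈1 (solves i) ⟨
      y i                                        ∎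

  -- The vector v and the p + q basis vectors satisfy a nontrivial relation, being more than n. If
  -- its coefficient at v were zero, the two eigenspace parts would be opposite, hence zero, and
  -- independence of both bases would make the relation trivial.
  eigenspaces-span : ∀ {n p q} (A : Matrix ℝ n) {x y} → x ≉ y → n ℕ.≤ p ℕ.+ q →
                     HasMultiplicity ℝ A x p → HasMultiplicity ℝ A y q → ∀ (v : Vector Carrier n) →
                     ∃[ u ] ∃[ w ] Eigenspace ℝ A x u × Eigenspace ℝ A y w × (∀ i → v i ≈ u i + w i)
  eigenspaces-span {n} {p} {q} A {x} {y} x≉y n≤p+q (b , isB) (d , isD) v
    with underdetermined (ℕ.s≤s n≤p+q) (λ i → v i ◂ (λ j → (b ++ d) j i))
  ... | t , t≉0 , solves = split (t zero ≟ 0#)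
    where
    module B = IsBasis isB
    module D = IsBasis isD

    α : Vector Carrier p
    α j = t (suc (j ↑ˡ q))

    β : Vector Carrier q
    β j = t (suc (p ↑ʳ j))

    u w : Vector Carrier n
    u = combination ℝ α b
    w = combination ℝ β d

    relation : ∀ i → v i * t zero + (u i + w i) ≈ 0#
    relation i = trans (+-congˡ (sym (trans (sum-splitAt p (λ j → (b ++ d) j i * t (suc j))) (+-cong
        (sum-cong-≋ (λ j → trans (*-congʳ (reflexive (≡.cong (λ s → [ b , d ]′ s i) (Fin.splitAt-↑ˡ p j q))))
                                 (*-comm (b j i) (α j))))
        (sum-cong-≋ (λ j → trans (*-congʳ (reflexive (≡.cong (λ s → [ b , d ]′ s i) (Fin.splitAt-↑ʳ p q j))))
                                 (*-comm (d j i) (β j))))))))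
      (solves i)

    eu : Eigenspace ℝ A x u
    eu = eigenspace-combination A x α B.member

    ew : Eigenspace ℝ A y w
    ew = eigenspace-combination A y β D.member

    scaled : ∀ s {z} {e : Vector Carrier n} → Eigenspace ℝ A z e → Eigenspace ℝ A z (λ i → s * e i)
    scaled s {z} {e} ez = eigenspace-cong A z
      (λ i → solve 2 (λ s e → s :* e :+ con (+ 0) :* e := s :* e) refl s (e i))
      (eigenspace-linear A z s 0# ez ez)

    split : _ → ∃[ u ] ∃[ w ] Eigenspace ℝ A x u × Eigenspace ℝ A y w × (∀ i → v i ≈ u i + w i)
    split (no t₀≉0) = let s , t₀s≈1 = inverse t₀≉0 in
      (λ i → - s * u i) , (λ i → - s * w i) , scaled (- s) eu , scaled (- s) ew ,
      (λ i → trans (solve-for t₀s≈1 (relation i)) (distribˡ (- s) (u i) (w i)))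
    split (yes t₀≈0) = contradiction t≈0 t≉0
      where
      u+w≈0 : ∀ i → u i + w i ≈ 0#
      u+w≈0 i = trans (sym (trans (+-congʳ (trans (*-congˡ t₀≈0) (zeroʳ (v i)))) (+-identityˡ _))) (relation i)

      u≈-w : ∀ i → - 1# * w i ≈ u i
      u≈-w i = begin
        - 1# * w i            ≈⟨ solve 2 (λ u w → (:- con (+ 1)) :* w := u :- (u :+ w)) refl (u i) (w i) ⟩
        u i - (u i + w i)     ≈⟨ +-congˡ (trans (-‿cong (u+w≈0 i)) -0#≈0#) ⟩
        u i + 0#              ≈⟨ +-identityʳ (u i) ⟩
        u i                   ∎

      u≈0 : IsZero u
      u≈0 = eigenspaces-independent A x≉y eu (eigenspace-cong A y u≈-w (scaled (- 1#) ew))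

      w≈0 : IsZero w
      w≈0 i = trans (sym (trans (+-congʳ (u≈0 i)) (+-identityˡ (w i)))) (u+w≈0 i)

      t≈0 : IsZero t
      t≈0 zero    = t₀≈0
      t≈0 (suc j) = ≡.subst (λ k → t (suc k) ≈ 0#) (Fin.join-splitAt p q j) (cases (splitAt p j))
        where
        cases : ∀ s → t (suc (join p q s)) ≈ 0#
        cases (inj₁ j) = B.independent α u≈0 j
        cases (inj₂ j) = D.independent β w≈0 j

  hasDimension-resp-⇔ : ∀ {n k p q} {S : Vector Carrier n → Set p} {T : Vector Carrier n → Set q} →
                        (∀ {v} → S v → T v) → (∀ {v} → T v → S v) → HasDimension ℝ S k → HasDimension ℝ T k
  hasDimension-resp-⇔ S⊆T T⊆S (b , isB) = b , record
    { member      = λ j → S⊆T (B.member j)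
    ; independent = B.independent
    ; spanning    = λ v Tv → B.spanning v (T⊆S Tv)
    }
    where module B = IsBasis isB

  units-basis : ∀ {n p} {S : Vector Carrier n → Set p} → (∀ v → S v) → HasDimension ℝ S n
  units-basis everything = unit , record
    { member      = λ j → everything (unit j)
    ; independent = λ a a≈0 i → trans (sym (combination-units a i)) (a≈0 i)
    ; spanning    = λ v _ → v , λ i → sym (combination-units v i)
    }
    where
    combination-units : ∀ {n} (a : Vector Carrier n) → combination ℝ a unit ≋ a
    combination-units a i = trans (sum-cong-≋ (λ j → *-congˡ (unit-sym j i))) (sum-unit a i)

  -- Some basis vector bₚ has φₚ = f · bₚ ≠ 0, since f does not vanish at g. Replacing every other
  -- bⱼ by φₚ bⱼ - φⱼ bₚ moves it into the hyperplane without a division, and bₚ is dropped.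
  hyperplane-dimension : ∀ {n m p} {S : Vector Carrier n → Set p} →
    (∀ a b {x y} → S x → S y → S (λ i → a * x i + b * y i)) → ∀ f {g} → S g → dot f g ≉ 0# →
    HasDimension ℝ S (suc m) → HasDimension ℝ (λ v → S v × dot f v ≈ 0#) m
  hyperplane-dimension {n} {m} {S = S} closed f {g} Sg fg≉0 (b , isB)
    with Fin.any? (λ j → ¬? (dot f (b j) ≟ 0#))
  ... | no  none        = contradiction fg≈0 fg≉0
    where
    g-spanned = IsBasis.spanning isB g Sg
    fg≈0 : dot f g ≈ 0#
    fg≈0 = trans (dot-cong {x = f} ≋-refl (proj₂ g-spanned)) (trans (dot-combination f (proj₁ g-spanned) b)
      (sum-zero (λ j → trans (*-congˡ (≈-stable (λ ≉0 → none (j , ≉0)))) (zeroʳ (proj₁ g-spanned j)))))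
  ... | yes (p , pivot) = b′ , record
    { member = λ j → closed (φ p) (- φ (punchIn p j)) (B.member (punchIn p j)) (B.member p) , in-hyperplane j
    ; independent = independent
    ; spanning = spanning
    }
    where
    module B = IsBasis isB

    φ : Fin (suc m) → Carrier
    φ j = dot f (b j)

    b′ : Vector (Vector Carrier n) m
    b′ j i = φ p * b (punchIn p j) i + - φ (punchIn p j) * b p i

    in-hyperplane : ∀ j → dot f (b′ j) ≈ 0#
    in-hyperplane j = trans (dot-linearʳ f (φ p) (- φ (punchIn p j)) (b (punchIn p j)) (b p))
      (solve 2 (λ x y → x :* y :+ (:- y) :* x := con (+ 0)) refl (φ p) (φ (punchIn p j)))

    combination-b′ : ∀ (a : Vector Carrier m) i → combination ℝ a b′ i ≈
      φ p * sum (λ j → a j * b (punchIn p j) i) + - b p i * sum (λ j → a j * φ (punchIn p j))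
    combination-b′ a i = trans
      (sum-cong-≋ (λ j → solve 5 (λ a x b y z → a :* (x :* b :+ (:- y) :* z) := x :* (a :* b) :+ (:- z) :* (a :* y))
        refl (a j) (φ p) (b (punchIn p j) i) (φ (punchIn p j)) (b p i)))
      (sum-linear (φ p) (- b p i) (λ j → a j * b (punchIn p j) i) (λ j → a j * φ (punchIn p j)))

    independent : ∀ a → combination ℝ a b′ ≋ replicate n 0# → a ≋ replicate m 0#
    independent a a≈0 j = *-cancelˡ-0 pivot
      (trans (reflexive (≡.sym (Vector.insertAt-punchIn (λ j → φ p * a j) p s j)))
             (B.independent a⁺ a⁺≈0 (punchIn p j)))
      where
      s : Carrier
      s = - sum (λ j → a j * φ (punchIn p j))

      -- The same relation rewritten in the old basis: φₚ aⱼ at the remaining vectors and the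
      -- collected coefficient `s` at bₚ.
      a⁺ : Vector Carrier (suc m)
      a⁺ = insertAt (λ j → φ p * a j) p s

      a⁺≈0 : IsZero (combination ℝ a⁺ b)
      a⁺≈0 i = begin
        sum (λ j → a⁺ j * b j i)
          ≈⟨ sum-remove {i = p} (λ j → a⁺ j * b j i) ⟩
        a⁺ p * b p i + sum (λ j → a⁺ (punchIn p j) * b (punchIn p j) i)
          ≈⟨ +-cong (*-congʳ (reflexive (Vector.insertAt-lookup _ p s)))
                    (sum-cong-≋ (λ j → trans (*-congʳ (reflexive (Vector.insertAt-punchIn _ p s j))) (*-assoc _ _ _))) ⟩
        s * b p i + sum (λ j → φ p * (a j * b (punchIn p j) i))
          ≈⟨ +-congˡ (*-distribˡ-sum (φ p) (λ j → a j * b (punchIn p j) i)) ⟨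
        s * b p i + φ p * sum (λ j → a j * b (punchIn p j) i)
          ≈⟨ solve 4 (λ t b x y → (:- t) :* b :+ x :* y := x :* y :+ (:- b) :* t) refl _ (b p i) (φ p) _ ⟩
        φ p * sum (λ j → a j * b (punchIn p j) i) + - b p i * sum (λ j → a j * φ (punchIn p j))
          ≈⟨ combination-b′ a i ⟨
        combination ℝ a b′ i
          ≈⟨ a≈0 i ⟩
        0# ∎

    spanning : ∀ v → S v × dot f v ≈ 0# → ∃[ a ] v ≋ combination ℝ a b′
    spanning v (Sv , fv≈0) with B.spanning v Sv | inverse pivot
    ... | a , v≋ab | r , φr≈1 = a′ , λ i → sym (begin
        combination ℝ a′ b′ i
          ≈⟨ combination-b′ a′ i ⟩
        φ p * sum (λ j → a′ j * b (punchIn p j) i) + - b p i * sum (λ j → a′ j * φ (punchIn p j))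
          ≈⟨ +-cong (*-congˡ (factor (λ j → b (punchIn p j) i))) (*-congˡ (factor (λ j → φ (punchIn p j)))) ⟩
        φ p * (r * tail-b i) + - b p i * (r * tail-φ)
          ≈⟨ solve 6 (λ F R T B U A → F :* (R :* T) :+ (:- B) :* (R :* U)
                                   := (F :* R) :* (A :* B :+ T) :- (B :* R) :* (A :* F :+ U))
               refl (φ p) r (tail-b i) (b p i) tail-φ (a p) ⟩
        φ p * r * (a p * b p i + tail-b i) - b p i * r * (a p * φ p + tail-φ)
          ≈⟨ +-cong (*-cong φr≈1 (sym (trans (v≋ab i) (sum-remove {i = p} (λ j → a j * b j i)))))
                    (-‿cong (*-congˡ φ-relation)) ⟩
        1# * v i - b p i * r * 0#
          ≈⟨ solve 2 (λ v x → con (+ 1) :* v :- x :* con (+ 0) := v) refl (v i) (b p i * r) ⟩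
        v i ∎)
      where
      -- Dividing by φₚ restores the coefficients at the remaining vectors; the one at bₚ then comes
      -- out right because f · v = 0.
      a′ : Vector Carrier m
      a′ j = r * a (punchIn p j)

      tail-b : Fin n → Carrier
      tail-b i = sum (λ j → a (punchIn p j) * b (punchIn p j) i)

      tail-φ : Carrier
      tail-φ = sum (λ j → a (punchIn p j) * φ (punchIn p j))

      factor : ∀ (x : Vector Carrier m) → sum (λ j → a′ j * x j) ≈ r * sum (λ j → a (punchIn p j) * x j)
      factor x = trans (sum-cong-≋ (λ j → *-assoc r _ (x j))) (sym (*-distribˡ-sum r (λ j → a (punchIn p j) * x j)))

      φ-relation : a p * φ p + tail-φ ≈ 0#
      φ-relation = trans (sym (sum-remove {i = p} (λ j → a j * φ j))) (trans (sym (dot-combination f a b))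
        (trans (dot-cong {x = f} ≋-refl (≋-sym v≋ab)) fv≈0))

-- Quadratic forms and extremal eigenvalues of symmetric matrices

module Spectral {c ℓ₁ ℓ₂} (ℝ : RealNumbers c ℓ₁ ℓ₂) where
  open OrderedField ℝ
  open LinearAlgebra ℝ
  open import Relation.Binary.Reasoning.Setoid setoid

  dot-linearˡ : ∀ {n} a b (x y z : Vector Carrier n) →
                dot (λ i → a * x i + b * y i) z ≈ a * dot x z + b * dot y z
  dot-linearˡ a b x y z = trans (dot-comm (λ i → a * x i + b * y i) z)
    (trans (dot-linearʳ z a b x y) (+-cong (*-congˡ (dot-comm z x)) (*-congˡ (dot-comm z y))))

  sum-nonneg : ∀ {n} {x : Vector Carrier n} → (∀ i → 0# ≤ x i) → 0# ≤ sum x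
  sum-nonneg {zero}  0≤x = ≤-refl
  sum-nonneg {suc n} 0≤x = 0≤+ (0≤x zero) (sum-nonneg (0≤x ∘ suc))

  sum-minus : ∀ {n} (x y : Vector Carrier n) → ∑[ i < n ] (x i - y i) ≈ sum x - sum y
  sum-minus x y = trans (∑-distrib-+ x (λ i → - y i)) (+-congˡ (sum-neg y))

  dot-nonneg : ∀ {n} (v : Vector Carrier n) → 0# ≤ dot v v
  dot-nonneg v = sum-nonneg (λ i → 0≤x² (v i))

  square≤dot : ∀ {n} (v : Vector Carrier n) i → 0# ≤ dot v v - v i * v i
  square≤dot v zero    = ≤-respʳ-≈
    (solve 2 (λ x y → y := x :+ y :- x) refl (v zero * v zero) _) (dot-nonneg (v ∘ suc))
  square≤dot v (suc i) = ≤-respʳ-≈ (sym (+-assoc _ _ _))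
    (0≤+ (0≤x² (v zero)) (square≤dot (v ∘ suc) i))

  dot-definite : ∀ {n} {v : Vector Carrier n} → dot v v ≈ 0# → IsZero v
  dot-definite {v = v} vv≈0 i = ≈-stable λ vᵢ≉0 →
    <⇒≱ (0<x² vᵢ≉0) (≤-respʳ-≈ vv≈0 (0≤-⇒≤ (square≤dot v i)))

  quad : ∀ {n} → Matrix ℝ n → Vector Carrier n → Carrier
  quad A v = dot v (mulVec ℝ A v)

  selfAdjoint : ∀ {n} {A : Matrix ℝ n} → IsSymmetric ℝ A → ∀ x y →
                dot x (mulVec ℝ A y) ≈ dot (mulVec ℝ A x) y
  selfAdjoint {A = A} symmetric x y = begin
    dot x (mulVec ℝ A y)                             ≈⟨ combination-assoc {n = 1} x A (λ j _ → y j) zero ⟩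
    sum (λ j → sum (λ i → x i * A i j) * y j)        ≈⟨ sum-cong-≋ (λ j → *-congʳ (sum-cong-≋ (λ i →
                                                          trans (*-comm (x i) (A i j)) (*-congʳ (symmetric i j))))) ⟩
    dot (mulVec ℝ A x) y                             ∎

  private
    -- Twice the bounded quantity is a sum of squares and of nonnegative multiples of the two
    -- hypotheses. The factor a² + 1 stands in for the absolute value of a.
    entry-bound : ∀ {a x y D} → 0# ≤ D - x * x → 0# ≤ D - y * y → 0# ≤ (a * a + 1#) * D - x * (a * y)
    entry-bound {a} {x} {y} {D} x²≤D y²≤D = halve-nonneg (≤-respʳ-≈
      (solve 4 (λ a x y D →
          con (+ 2) :* (a :* a :* (D :- x :* x) :+ (D :- y :* y))
            :+ (a :* x :* (a :* x) :+ y :* y :+ (a :* x :- y) :* (a :* x :- y))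
          := ((a :* a :+ con (+ 1)) :* D :- x :* (a :* y)) :+ ((a :* a :+ con (+ 1)) :* D :- x :* (a :* y)))
        refl a x y D)
      (0≤+ (0≤* (inj₁ (0<ι 1)) (0≤+ (0≤* (0≤x² a) x²≤D) y²≤D))
           (0≤+ (0≤+ (0≤x² (a * x)) (0≤x² y)) (0≤x² (a * x - y)))))

  quad-bounded : ∀ {n} (A : Matrix ℝ n) → ∃[ K ] 0# < K × (∀ v → quad A v ≤ K * dot v v)
  -- The summand `1#` keeps the bound positive even in dimension zero, so that it can be inverted
  -- later.
  quad-bounded A = 1# + L , 0<+≤ 0<1 0≤L , λ v → 0≤-⇒≤ (≤-respʳ-≈ (difference v)
      (0≤+ (dot-nonneg v) (sum-nonneg (λ i → sum-nonneg (λ j → entry-bound (square≤dot v i) (square≤dot v j))))))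
    where
    k : Matrix ℝ _
    k i j = A i j * A i j + 1#

    L : Carrier
    L = sum (λ i → sum (k i))

    0≤L : 0# ≤ L
    0≤L = sum-nonneg (λ i → sum-nonneg (λ j → 0≤+ (0≤x² (A i j)) (inj₁ 0<1)))

    difference : ∀ v → dot v v + sum (λ i → sum (λ j → k i j * dot v v - v i * (A i j * v j))) ≈
                       (1# + L) * dot v v - quad A v
    difference v = begin
      D + sum (λ i → sum (λ j → k i j * D - v i * (A i j * v j)))
        ≈⟨ +-congˡ (sum-cong-≋ (λ i → trans (sum-minus (λ j → k i j * D) (λ j → v i * (A i j * v j)))
             (sym (+-cong (*-distribʳ-sum D (k i)) (-‿cong (*-distribˡ-sum (v i) (λ j → A i j * v j))))))) ⟩
      D + sum (λ i → sum (k i) * D - v i * mulVec ℝ A v i)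
        ≈⟨ +-congˡ (trans (sum-minus (λ i → sum (k i) * D) (λ i → v i * mulVec ℝ A v i))
                          (+-congʳ (sym (*-distribʳ-sum D (λ i → sum (k i)))))) ⟩
      D + (L * D - quad A v)
        ≈⟨ solve 3 (λ D L q → D :+ (L :* D :- q) := (con (+ 1) :+ L) :* D :- q) refl D L (quad A v) ⟩
      (1# + L) * D - quad A v ∎
      where
      D = dot v v

  shift : ∀ {n} → Matrix ℝ n → Carrier → Matrix ℝ n
  shift A s i j = A i j - s * unit i j

  shift-sym : ∀ {n} {A : Matrix ℝ n} s → IsSymmetric ℝ A → IsSymmetric ℝ (shift A s)
  shift-sym s symmetric i j = +-cong (symmetric i j) (-‿cong (*-congˡ (unit-sym i j)))

  mulVec-shift : ∀ {n} (A : Matrix ℝ n) s v i → mulVec ℝ (shift A s) v i ≈ mulVec ℝ A v i - s * v i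
  mulVec-shift A s v i = begin
    sum (λ j → (A i j - s * unit i j) * v j)           ≈⟨ sum-cong-≋ (λ j → solve 4 (λ a s e v →
                                                            (a :- s :* e) :* v := con (+ 1) :* (a :* v) :+ (:- s) :* (v :* e))
                                                            refl (A i j) s (unit i j) (v j)) ⟩
    sum (λ j → 1# * (A i j * v j) + - s * (v j * unit i j))
                                                       ≈⟨ sum-linear 1# (- s) (λ j → A i j * v j) (λ j → v j * unit i j) ⟩
    1# * mulVec ℝ A v i + - s * sum (λ j → v j * unit i j)
                                                       ≈⟨ +-cong (*-identityˡ _) (*-congˡ (sum-unit v i)) ⟩
    mulVec ℝ A v i + - s * v i                         ≈⟨ solve 3 (λ m s v → m :+ (:- s) :* v := m :- s :* v) refl _ s (v i) ⟩
    mulVec ℝ A v i - s * v i                           ∎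

  quad-shift : ∀ {n} (A : Matrix ℝ n) s v → quad (shift A s) v ≈ quad A v - s * dot v v
  quad-shift A s v = begin
    dot v (mulVec ℝ (shift A s) v)                           ≈⟨ dot-cong {x = v} ≋-refl (λ i → trans (mulVec-shift A s v i)
                                                                  (solve 3 (λ m s v → m :- s :* v := con (+ 1) :* m :+ (:- s) :* v)
                                                                    refl (mulVec ℝ A v i) s (v i))) ⟩
    dot v (λ i → 1# * mulVec ℝ A v i + - s * v i)            ≈⟨ dot-linearʳ v 1# (- s) (mulVec ℝ A v) v ⟩
    1# * quad A v + - s * dot v v                            ≈⟨ solve 3 (λ m s v → con (+ 1) :* m :+ (:- s) :* v := m :- s :* v)
                                                                  refl (quad A v) s (dot v v) ⟩
    quad A v - s * dot v v                                   ∎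

  right-inverse : ∀ {n} (B : Matrix ℝ n) → (∀ x → IsZero (mulVec ℝ B x) → IsZero x) →
                  ∃[ C ] (∀ x → mulVec ℝ B (mulVec ℝ C x) ≋ x)
  right-inverse B injective = C , λ x i → begin
    mulVec ℝ B (mulVec ℝ C x) i                    ≈⟨ mulVec-assoc B C x i ⟩
    sum (λ j → mulVec ℝ B (λ k → C k j) i * x j)   ≈⟨ sum-cong-≋ (λ j → trans
                                                        (*-congʳ (proj₂ (preimage (unit j)) i))
                                                        (trans (*-comm _ (x j)) (*-congˡ (unit-sym j i)))) ⟩
    sum (λ j → x j * unit i j)                     ≈⟨ sum-unit x i ⟩
    x i                                            ∎
    where
    preimage = injective⇒surjective B injective
    C : Matrix ℝ _
    C i j = proj₁ (preimage (unit j)) i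

  -- If B u = v, then 0 ≤ q(v - t u) = q(v) - 2 t v·v + t² u·v, and t is chosen
  -- so small that t² u·v ≤ t v·v.
  coercive : ∀ {n} {B C : Matrix ℝ n} → IsSymmetric ℝ B → (∀ v → 0# ≤ quad B v) →
             (∀ x → mulVec ℝ B (mulVec ℝ C x) ≋ x) →
             ∀ {K} → (∀ v → quad C v ≤ K * dot v v) → ∀ {t} → K * t ≈ 1# →
             ∀ v → t * dot v v ≤ quad B v
  coercive {B = B} {C} symmetric nonneg BC≈1 {K} bound {t} Kt≈1 v = 0≤-⇒≤ (≤-respʳ-≈ (estimate v)
      (0≤+ (nonneg (λ i → 1# * v i + - t * mulVec ℝ C v i)) (0≤* (0≤x² t) (≤⇒0≤- (bound v)))))
    where
    expand : ∀ v → quad B (λ i → 1# * v i + - t * mulVec ℝ C v i) ≈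
                   quad B v - (t + t) * dot v v + t * t * quad C v
    expand v = begin
      quad B z
        ≈⟨ dot-cong {x = z} ≋-refl (λ i → trans (dot-linearʳ (B i) 1# (- t) v u) (+-congˡ (*-congˡ (BC≈1 v i)))) ⟩
      dot z (λ i → 1# * mulVec ℝ B v i + - t * v i)
        ≈⟨ dot-linearʳ z 1# (- t) (mulVec ℝ B v) v ⟩
      1# * dot z (mulVec ℝ B v) + - t * dot z v
        ≈⟨ +-cong (*-congˡ (dot-linearˡ 1# (- t) v u (mulVec ℝ B v))) (*-congˡ (dot-linearˡ 1# (- t) v u v)) ⟩
      1# * (1# * quad B v + - t * dot u (mulVec ℝ B v)) + - t * (1# * dot v v + - t * dot u v)
        ≈⟨ +-cong (*-congˡ (+-congˡ (*-congˡ u·Bv≈v·v)))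
                  (*-congˡ (+-congˡ (*-congˡ (dot-comm u v)))) ⟩
      1# * (1# * quad B v + - t * dot v v) + - t * (1# * dot v v + - t * quad C v)
        ≈⟨ solve 4 (λ q t d e → con (+ 1) :* (con (+ 1) :* q :+ (:- t) :* d) :+ (:- t) :* (con (+ 1) :* d :+ (:- t) :* e)
             := q :- (t :+ t) :* d :+ t :* t :* e) refl (quad B v) t (dot v v) (quad C v) ⟩
      quad B v - (t + t) * dot v v + t * t * quad C v ∎
      where
      u = mulVec ℝ C v
      z = λ i → 1# * v i + - t * u i

      u·Bv≈v·v : dot u (mulVec ℝ B v) ≈ dot v v
      u·Bv≈v·v = trans (selfAdjoint {A = B} symmetric u v)
        (dot-cong {x = mulVec ℝ B u} {x′ = v} {y = v} {y′ = v} (BC≈1 v) ≋-refl)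

    estimate : ∀ v → quad B (λ i → 1# * v i + - t * mulVec ℝ C v i) + t * t * (K * dot v v - quad C v) ≈
                     quad B v - t * dot v v
    estimate v = begin
      quad B (λ i → 1# * v i + - t * mulVec ℝ C v i) + t * t * (K * dot v v - quad C v)
        ≈⟨ +-congʳ (expand v) ⟩
      quad B v - (t + t) * dot v v + t * t * quad C v + t * t * (K * dot v v - quad C v)
        ≈⟨ solve 5 (λ q t d e K → q :- (t :+ t) :* d :+ t :* t :* e :+ t :* t :* (K :* d :- e)
                               := q :- (t :+ t) :* d :+ (K :* t) :* (t :* d)) refl (quad B v) t (dot v v) (quad C v) K ⟩
      quad B v - (t + t) * dot v v + K * t * (t * dot v v)
        ≈⟨ +-congˡ (*-congʳ Kt≈1) ⟩
      quad B v - (t + t) * dot v v + 1# * (t * dot v v)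
        ≈⟨ solve 3 (λ q t d → q :- (t :+ t) :* d :+ con (+ 1) :* (t :* d) := q :- t :* d) refl (quad B v) t (dot v v) ⟩
      quad B v - t * dot v v ∎

  -- Replaces the compactness of the unit sphere: t is the reciprocal of a bound for the form of an
  -- inverse of B.
  nonsingular⇒coercive : ∀ {n} {B : Matrix ℝ n} → IsSymmetric ℝ B → (∀ v → 0# ≤ quad B v) →
                         (∀ x → IsZero (mulVec ℝ B x) → IsZero x) →
                         ∃[ t ] 0# < t × (∀ v → t * dot v v ≤ quad B v)
  nonsingular⇒coercive {B = B} symmetric nonneg injective =
    let C , BC≈1        = right-inverse B injective
        K , 0<K , bound = quad-bounded C
        t , 0<t , Kt≈1  = inverse-pos 0<K
    in t , 0<t , coercive {B = B} {C} symmetric nonneg BC≈1 bound Kt≈1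

  IsLowerBound : ∀ {n} → Matrix ℝ n → Carrier → Set _
  IsLowerBound A t = ∀ v → t * dot v v ≤ quad A v

  -- Suppose q < s D, where q = v · A v and D = v · v. Then D ≠ 0, as D = 0 forces v = 0 and q = 0.
  -- So q / D bounds all lower bounds from above and is less than s, against the choice of s.
  supremum-attained : ∀ {n} (A : Matrix ℝ n) {s} →
                      (∀ b → (∀ t → IsLowerBound A t → t ≤ b) → s ≤ b) → IsLowerBound A s
  supremum-attained A {s} least v = ≮⇒≥ λ q<sD → absurd q<sD (dot-nonneg v)
    where
    D = dot v v
    q = quad A v

    absurd : q < s * D → ¬ (0# ≤ D)
    absurd q<sD (inj₂ 0≈D) = irrefl (trans q≈0 (sym (trans (*-congˡ (sym 0≈D)) (zeroʳ s)))) q<sD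
      where
      q≈0 : q ≈ 0#
      q≈0 = sum-zero (λ i → trans (*-congʳ (dot-definite {v = v} (sym 0≈D) i)) (zeroˡ _))
    absurd q<sD (inj₁ 0<D) with inverse-pos 0<D
    ... | r , 0<r , Dr≈1 = <⇒≱ (<-respʳ-≈ (scaled s) (*-mono-< 0<r q<sD))
          (least (r * q) (λ t lower → ≮⇒≥ λ rq<t → <⇒≱
            (<-respʳ-≈ (*-comm D t) (<-respˡ-≈ (unscaled q) (*-mono-< 0<D rq<t))) (lower v)))
      where
      scaled : ∀ x → r * (x * D) ≈ x
      scaled x = trans (solve 3 (λ r x D → r :* (x :* D) := x :* (D :* r)) refl r x D)
                       (trans (*-congˡ Dr≈1) (*-identityʳ x))
      unscaled : ∀ x → D * (r * x) ≈ x
      unscaled x = trans (sym (*-assoc D r x)) (trans (*-congʳ Dr≈1) (*-identityˡ x))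

  negate : ∀ {n} → Matrix ℝ n → Matrix ℝ n
  negate A i j = - A i j

  mulVec-negate : ∀ {n} (A : Matrix ℝ n) v i → mulVec ℝ (negate A) v i ≈ - mulVec ℝ A v i
  mulVec-negate A v i = trans
    (sum-cong-≋ (λ j → solve 2 (λ a v → (:- a) :* v := :- (a :* v)) refl (A i j) (v j)))
    (sum-neg (λ j → A i j * v j))

  quad-negate : ∀ {n} (A : Matrix ℝ n) v → quad (negate A) v ≈ - quad A v
  quad-negate A v = trans
    (sum-cong-≋ (λ i → trans (*-congˡ (mulVec-negate A v i))
      (solve 2 (λ a v → v :* (:- a) := :- (v :* a)) refl (mulVec ℝ A v i) (v i))))
    (sum-neg (λ i → v i * mulVec ℝ A v i))

  lowerBound : ∀ {n} (A : Matrix ℝ n) → ∃ (IsLowerBound A)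
  lowerBound A = let K , _ , bound = quad-bounded (negate A) in
    - K , λ v → 0≤-⇒≤ (≤-respʳ-≈
      (trans (+-congˡ (-‿cong (quad-negate A v)))
        (solve 3 (λ K d q → K :* d :- (:- q) := q :- (:- K) :* d) refl K (dot v v) (quad A v)))
      (≤⇒0≤- (bound v)))

  -- Testing with one unit vector suffices. In dimension zero every number is a lower bound, hence
  -- the index `suc n`.
  lowerBounds-bounded : ∀ {n} (A : Matrix ℝ (suc n)) → ∃ (UpperBound (IsLowerBound A))
  lowerBounds-bounded {n} A = quad A e , λ t lower → 0≤-⇒≤ (≤-respʳ-≈
    (+-congˡ (-‿cong (trans (*-congˡ (sum-unit e zero)) (*-identityʳ t)))) (≤⇒0≤- (lower e)))
    where
    e : Vector Carrier (suc n)
    e = unit zero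

  greatest-lowerBound⇒singular : ∀ {n} {A : Matrix ℝ n} → IsSymmetric ℝ A → ∀ {s} →
    IsLowerBound A s → UpperBound (IsLowerBound A) s → ¬ (∀ v → Eigenspace ℝ A s v → IsZero v)
  greatest-lowerBound⇒singular {A = A} symmetric {s} attained upper trivial-kernel =
    let t , 0<t , t-lower = nonsingular⇒coercive {B = shift A s} (shift-sym {A = A} s symmetric) nonneg injective
    in <⇒≱ (<-respʳ-≈ (+-comm t s) (<-respˡ-≈ (+-identityˡ s) (+-monoˡ-< s 0<t)))
           (upper (s + t) (larger t-lower))
    where
    nonneg : ∀ v → 0# ≤ quad (shift A s) v
    nonneg v = ≤-respʳ-≈ (sym (quad-shift A s v)) (≤⇒0≤- (attained v))

    injective : ∀ v → IsZero (mulVec ℝ (shift A s) v) → IsZero v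
    injective v Bv≈0 = trivial-kernel v λ i →
      x∙y⁻¹≈ε⇒x≈y _ _ (trans (sym (mulVec-shift A s v i)) (Bv≈0 i))

    larger : ∀ {t} → (∀ v → t * dot v v ≤ quad (shift A s) v) → IsLowerBound A (s + t)
    larger {t} t-lower v = 0≤-⇒≤ (≤-respʳ-≈
      (trans (+-congʳ (quad-shift A s v))
        (solve 4 (λ q s t d → q :- s :* d :- t :* d := q :- (s :+ t) :* d) refl (quad A v) s t (dot v v)))
      (≤⇒0≤- (t-lower v)))

  minimal-eigenvalue : ∀ {n} {A : Matrix ℝ (suc n)} → IsSymmetric ℝ A →
                       ∃[ s ] IsLowerBound A s × ¬ (∀ v → Eigenspace ℝ A s v → IsZero v)
  minimal-eigenvalue {A = A} symmetric =
    let s , upper , least = complete (IsLowerBound A) (lowerBound A) (lowerBounds-bounded A)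
        attained          = supremum-attained A least
    in s , attained , greatest-lowerBound⇒singular {A = A} symmetric attained upper

  -- The double negation remains because the kernel was shown nontrivial by contradiction only. It
  -- is used solely to derive equations, which are stable, and contradictions.
  eigenvalue-unless : ∀ {n} (A : Matrix ℝ n) x → ¬ (∀ v → Eigenspace ℝ A x v → IsZero v) →
                      ¬ ¬ IsEigenvalue ℝ A x
  eigenvalue-unless A x nontrivial none = nontrivial λ v ev i →
    ≈-stable (λ vᵢ≉0 → none (v , (λ v≈0 → vᵢ≉0 (v≈0 i)) , ev))

  -- Polarisation: the form at eᵢ + eⱼ equals the forms at eᵢ and eⱼ plus twice the entry.
  quad≡0⇒zero : ∀ {n} {B : Matrix ℝ n} → IsSymmetric ℝ B → (∀ v → quad B v ≈ 0#) → ∀ i j → B i j ≈ 0#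
  quad≡0⇒zero {B = B} symmetric q≈0 i j = trans (sym (mulVec-unit B j i))
    (trans (sym entry) (*-cancelˡ-0 (>⇒≉ (0<ι 1)) double))
    where
    x = unit i
    y = unit j

    entry : dot x (mulVec ℝ B y) ≈ mulVec ℝ B y i
    entry = trans (dot-comm x (mulVec ℝ B y)) (sum-unit (mulVec ℝ B y) i)

    z = λ k → 1# * x k + 1# * y k

    double : ι (+ 2) * dot x (mulVec ℝ B y) ≈ 0#
    double = begin
      ι (+ 2) * dot x (mulVec ℝ B y)
        ≈⟨ solve 1 (λ d → con (+ 2) :* d := con (+ 1) :* (con (+ 1) :* con (+ 0) :+ con (+ 1) :* d)
                          :+ con (+ 1) :* (con (+ 1) :* d :+ con (+ 1) :* con (+ 0))) refl _ ⟩
      1# * (1# * 0# + 1# * dot x (mulVec ℝ B y)) + 1# * (1# * dot x (mulVec ℝ B y) + 1# * 0#)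
        ≈⟨ +-cong (*-congˡ (+-cong (*-congˡ (q≈0 x)) (*-congˡ (trans (dot-comm y (mulVec ℝ B x))
                                                               (sym (selfAdjoint {A = B} symmetric x y))))))
                  (*-congˡ (+-congˡ (*-congˡ (q≈0 y)))) ⟨
      1# * (1# * quad B x + 1# * dot y (mulVec ℝ B x)) + 1# * (1# * dot x (mulVec ℝ B y) + 1# * quad B y)
        ≈⟨ +-cong (*-congˡ (dot-linearˡ 1# 1# x y (mulVec ℝ B x))) (*-congˡ (dot-linearˡ 1# 1# x y (mulVec ℝ B y))) ⟨
      1# * dot z (mulVec ℝ B x) + 1# * dot z (mulVec ℝ B y)
        ≈⟨ dot-linearʳ z 1# 1# (mulVec ℝ B x) (mulVec ℝ B y) ⟨
      dot z (λ k → 1# * mulVec ℝ B x k + 1# * mulVec ℝ B y k)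
        ≈⟨ dot-cong {x = z} ≋-refl (λ k → dot-linearʳ (B k) 1# 1# x y) ⟨
      quad B z
        ≈⟨ q≈0 z ⟩
      0# ∎

  unique-eigenvalue⇒scalar : ∀ {n} {A : Matrix ℝ (suc n)} → IsSymmetric ℝ A → ∀ {x} →
                             (∀ y → IsEigenvalue ℝ A y → x ≈ y) → ∀ v → quad A v ≈ x * dot v v
  unique-eigenvalue⇒scalar {A = A} symmetric {x} only v = ≤-antisym
    (above (minimal-eigenvalue {A = negate A} (λ i j → -‿cong (symmetric i j))) v)
    (below (minimal-eigenvalue {A = A} symmetric) v)
    where
    x≈s : ∀ {s} → ¬ (∀ v → Eigenspace ℝ A s v → IsZero v) → x ≈ s
    x≈s {s} nontrivial = ≈-stable λ x≉s →
      eigenvalue-unless A s nontrivial λ eigenvalue → x≉s (only s eigenvalue)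

    x≈-r : ∀ {r} → ¬ (∀ v → Eigenspace ℝ (negate A) r v → IsZero v) → x ≈ - r
    x≈-r {r} nontrivial = ≈-stable λ x≉-r →
      eigenvalue-unless (negate A) r nontrivial λ (v , v≉0 , ev) → x≉-r (only (- r) (v , v≉0 , λ i → begin
        mulVec ℝ A v i               ≈⟨ solve 1 (λ a → a := :- (:- a)) refl (mulVec ℝ A v i) ⟩
        - - mulVec ℝ A v i           ≈⟨ -‿cong (mulVec-negate A v i) ⟨
        - mulVec ℝ (negate A) v i    ≈⟨ -‿cong (ev i) ⟩
        - (r * v i)                  ≈⟨ solve 2 (λ r v → :- (r :* v) := (:- r) :* v) refl r (v i) ⟩
        - r * v i                    ∎))

    below : (∃[ s ] IsLowerBound A s × ¬ (∀ v → Eigenspace ℝ A s v → IsZero v)) → IsLowerBound A x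
    below (s , lower , nontrivial) v =
      0≤-⇒≤ (≤-respʳ-≈ (+-congˡ (-‿cong (*-congʳ (sym (x≈s nontrivial))))) (≤⇒0≤- (lower v)))

    above : (∃[ r ] IsLowerBound (negate A) r × ¬ (∀ v → Eigenspace ℝ (negate A) r v → IsZero v)) →
            ∀ v → quad A v ≤ x * dot v v
    above (r , lower , nontrivial) v = 0≤-⇒≤ (≤-respʳ-≈ (begin
      quad (negate A) v - r * dot v v  ≈⟨ +-congʳ (quad-negate A v) ⟩
      - quad A v - r * dot v v         ≈⟨ solve 3 (λ q r d → (:- q) :- r :* d := (:- r) :* d :- q) refl (quad A v) r (dot v v) ⟩
      - r * dot v v - quad A v         ≈⟨ +-congʳ (*-congʳ (x≈-r nontrivial)) ⟨
      x * dot v v - quad A v           ∎) (≤⇒0≤- (lower v)))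

  -- The least eigenvalue excludes m = 0. For m = 1 with eigenvalue x, the form of A - x vanishes,
  -- so A has no nonzero off-diagonal entry. Being off the diagonal is phrased as `unit i j ≈ 0#`,
  -- which is `refl` for concrete indices.
  two-distinct-eigenvalues : ∀ {n m} {A : Matrix ℝ (suc n)} → IsSymmetric ℝ A →
                             ∀ {i j} → unit i j ≈ 0# → A i j ≉ 0# → IsQᴹ ℝ A m → 2 ℕ.≤ m
  two-distinct-eigenvalues {m = suc (suc m)} _ _ _ _ = ℕ.s≤s (ℕ.s≤s ℕ.z≤n)
  two-distinct-eigenvalues {m = zero} {A} symmetric _ _ (_ , spectrum) =
    contradiction (minimal-eigenvalue {A = A} symmetric) none
    where
    none : ¬ (∃[ s ] IsLowerBound A s × ¬ (∀ v → Eigenspace ℝ A s v → IsZero v))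
    none (s , _ , nontrivial) = eigenvalue-unless A s nontrivial λ eigenvalue →
      contradiction (proj₁ (DistinctEigenvalues.exhaustive spectrum s eigenvalue)) λ ()
  two-distinct-eigenvalues {m = suc zero} {A} symmetric {i} {j} offDiagonal Aij≉0 (e , spectrum) =
    contradiction Aij≈0 Aij≉0
    where
    open DistinctEigenvalues spectrum

    x : Carrier
    x = e zero

    only : ∀ y → IsEigenvalue ℝ A y → x ≈ y
    only y eigenvalue with exhaustive y eigenvalue
    ... | zero , x≈y = x≈y

    Aij≈0 : A i j ≈ 0#
    Aij≈0 = begin
      A i j                   ≈⟨ solve 2 (λ a x → a := a :- x :* con (+ 0)) refl (A i j) x ⟩
      A i j - x * 0#          ≈⟨ +-congˡ (-‿cong (*-congˡ offDiagonal)) ⟨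
      shift A x i j           ≈⟨ quad≡0⇒zero {B = shift A x} (shift-sym {A = A} x symmetric)
                                   (λ v → trans (quad-shift A x v) (x≈y⇒x∙y⁻¹≈ε
                                     (unique-eigenvalue⇒scalar {A = A} symmetric only v))) i j ⟩
      0#                      ∎

-- Projections with the pattern of the complement of the path have rank at least three

module LowerBound {c ℓ₁ ℓ₂} (ℝ : RealNumbers c ℓ₁ ℓ₂) where
  open OrderedField ℝ
  open LinearAlgebra ℝ
  open Spectral ℝ
  open import Relation.Binary.Reasoning.Setoid setoid

  unit-≢ : ∀ {n} {i j : Fin n} → i ≢ j → unit i j ≈ 0#
  unit-≢ {i = zero}  {zero}  i≢j = contradiction ≡.refl i≢j
  unit-≢ {i = zero}  {suc j} i≢j = refl
  unit-≢ {i = suc i} {zero}  i≢j = refl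
  unit-≢ {i = suc i} {suc j} i≢j = unit-≢ (i≢j ∘ ≡.cong suc)

  module _ {n} {A : Matrix ℝ n} (realizes : Realizes ℝ (complement (path n)) A) where
    open Realizes realizes

    consecutive⇒0 : ∀ {i j} → SimpleGraph.Adj (path n) i j → A i j ≈ 0#
    consecutive⇒0 {i} {j} adj = ≈-stable λ ≉0 →
      proj₂ (Equivalence.to (pattern-⇔ i j λ i≡j → SimpleGraph.adj-irrefl (path n) i≡j adj) ≉0) adj

    nonconsecutive⇒≉0 : ∀ {i j} → i ≢ j → ¬ SimpleGraph.Adj (path n) i j → A i j ≉ 0#
    nonconsecutive⇒≉0 {i} {j} i≢j ¬adj = Equivalence.from (pattern-⇔ i j i≢j) (i≢j , ¬adj)

  -- Row i of a projection has squared length P i i, so a zero on the diagonal annihilates the row.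
  -- This is applied to vertices 1 and 2 with the nonzero entries at 3 and 4 as witnesses, whence
  -- the five vertices below.
  projection-diagonal : ∀ {n} {P : Matrix ℝ n} → IsOrthogonalProjection ℝ P →
                        ∀ i {j} → P i j ≉ 0# → P i i ≉ 0#
  projection-diagonal {P = P} projection i {j} Pij≉0 Pii≈0 = Pij≉0 (dot-definite {v = P i} (begin
    dot (P i) (P i)     ≈⟨ dot-cong {x = P i} ≋-refl (λ k → symmetric i k) ⟩
    mulMat ℝ P P i i    ≈⟨ idempotent i i ⟩
    P i i               ≈⟨ Pii≈0 ⟩
    0#                  ∎) j)
    where open IsOrthogonalProjection projection

  private
    v₀ v₁ v₂ v₃ v₄ : ∀ {n} → Fin (5 ℕ.+ n)
    v₀ = zero
    v₁ = suc zero
    v₂ = suc (suc zero)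
    v₃ = suc (suc (suc zero))
    v₄ = suc (suc (suc (suc zero)))

  -- Rows 1, 3 and 2 show, in this order, that the columns 0, 1 and 2 are
  -- independent.
  column-rank≥3 : ∀ {n k} {P : Matrix ℝ (5 ℕ.+ n)} →
    Realizes ℝ (complement (path (5 ℕ.+ n))) P → IsOrthogonalProjection ℝ P →
    (b : Vector (Vector Carrier (5 ℕ.+ n)) k) → (∀ j → ∃[ a ] (λ i → P i j) ≋ combination ℝ a b) → 3 ℕ.≤ k
  column-rank≥3 {n} {k} {P} realizes projection b spans = ℕ.≮⇒≥ λ k<3 →
    let x , x≉0 , relation = too-many-vectors k<3 b (λ j i → P i (vertex j)) (λ j → spans (vertex j))
    in x≉0 (trivial x relation)
    where
    vertex : Fin 3 → Fin (5 ℕ.+ n)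
    vertex zero             = v₀
    vertex (suc zero)       = v₁
    vertex (suc (suc zero)) = v₂

    first : ∀ {x y z a b c} → x * a + (y * b + (z * c + 0#)) ≈ 0# → a ≉ 0# → y * b ≈ 0# → z * c ≈ 0# → x ≈ 0#
    first {x} {y} {z} {a} {b} {c} sum≈0 a≉0 yb≈0 zc≈0 = *-cancelˡ-0 a≉0 (begin
      a * x                                     ≈⟨ solve 4 (λ a x p q → a :* x := x :* a :+ (p :+ (q :+ con (+ 0))) :- (p :+ q))
                                                     refl a x (y * b) (z * c) ⟩
      x * a + (y * b + (z * c + 0#)) - (y * b + z * c)
                                                ≈⟨ +-cong sum≈0 (-‿cong (+-cong yb≈0 zc≈0)) ⟩
      0# - (0# + 0#)                            ≈⟨ solve 0 (con (+ 0) :- (con (+ 0) :+ con (+ 0)) := con (+ 0)) refl ⟩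
      0#                                        ∎)

    rotate : ∀ {a b c} → a + (b + (c + 0#)) ≈ 0# → b + (c + (a + 0#)) ≈ 0#
    rotate {a} {b} {c} = trans (solve 3 (λ a b c → b :+ (c :+ (a :+ con (+ 0))) := a :+ (b :+ (c :+ con (+ 0)))) refl a b c)

    *-0ʳ : ∀ x {y} → y ≈ 0# → x * y ≈ 0#
    *-0ʳ x y≈0 = trans (*-congˡ y≈0) (zeroʳ x)

    *-0ˡ : ∀ {x} y → x ≈ 0# → x * y ≈ 0#
    *-0ˡ y x≈0 = trans (*-congʳ x≈0) (zeroˡ y)

    trivial : ∀ (x : Vector Carrier 3) → IsZero (combination ℝ x (λ j i → P i (vertex j))) → IsZero x
    trivial x relation = λ where
        zero             → x₀≈0
        (suc zero)       → x₁≈0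
        (suc (suc zero)) → x₂≈0
      where
      P≈0 = consecutive⇒0 realizes
      P≉0 = nonconsecutive⇒≉0 realizes

      -- Row 1 vanishes in columns 0 and 2, so only its diagonal term survives. Row 3 then isolates
      -- column 0, and row 2 leaves column 2. `rotate` brings the surviving term to the front, where
      -- `first` expects it.
      x₁≈0 : x (suc zero) ≈ 0#
      x₁≈0 = first (rotate (relation v₁))
        (projection-diagonal projection v₁ (P≉0 {v₁} {v₃} (λ ()) λ { (inj₁ ()) ; (inj₂ ()) }))
        (*-0ʳ (x (suc (suc zero))) (P≈0 {v₁} {v₂} (inj₁ ≡.refl)))
        (*-0ʳ (x zero) (P≈0 {v₁} {v₀} (inj₂ ≡.refl)))

      x₀≈0 : x zero ≈ 0#
      x₀≈0 = first (relation v₃)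
        (P≉0 {v₃} {v₀} (λ ()) λ { (inj₁ ()) ; (inj₂ ()) })
        (*-0ˡ (P v₃ v₁) x₁≈0)
        (*-0ʳ (x (suc (suc zero))) (P≈0 {v₃} {v₂} (inj₂ ≡.refl)))

      x₂≈0 : x (suc (suc zero)) ≈ 0#
      x₂≈0 = first (rotate (rotate (relation v₂)))
        (projection-diagonal projection v₂ (P≉0 {v₂} {v₄} (λ ()) λ { (inj₁ ()) ; (inj₂ ()) }))
        (*-0ˡ (P v₂ v₀) x₀≈0)
        (*-0ˡ (P v₂ v₁) x₁≈0)

  rank≥3 : ∀ {n k} {P : Matrix ℝ (5 ℕ.+ n)} →
    Realizes ℝ (complement (path (5 ℕ.+ n))) P → IsOrthogonalProjection ℝ P → HasRank ℝ P k → 3 ℕ.≤ k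
  rank≥3 {P = P} realizes projection (b , isB) = column-rank≥3 realizes projection b λ j →
    IsBasis.spanning isB (λ i → P i j) (unit j , mulVec-unit P j)

  -- (A − x) / (y − x) is the projection onto the eigenspace at y along the one at x.
  module _ {n} {A : Matrix ℝ n} {x y : Carrier} (symmetric : IsSymmetric ℝ A)
    {r : Carrier} (y-x-inverse : (y - x) * r ≈ 1#)
    (span : ∀ (v : Vector Carrier n) → ∃[ u ] ∃[ w ] Eigenspace ℝ A x u × Eigenspace ℝ A y w × (∀ i → v i ≈ u i + w i))
    where

    spectralProjection : Matrix ℝ n
    spectralProjection i j = r * shift A x i j

    private
      P = spectralProjection

    mulVec-spectralProjection : ∀ v i → mulVec ℝ P v i ≈ r * (mulVec ℝ A v i - x * v i)
    mulVec-spectralProjection v i = trans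
      (sum-cong-≋ (λ j → *-assoc r (shift A x i j) (v j)))
      (trans (sym (*-distribˡ-sum r (λ j → shift A x i j * v j))) (*-congˡ (mulVec-shift A x v i)))

    -- For v = u + w, the matrix A - x kills u and multiplies w by y - x; hence P v = w.
    spectralProjection-image : ∀ v → Eigenspace ℝ A y (mulVec ℝ P v)
    spectralProjection-image v with span v
    ... | u , w , eu , ew , v≈u+w = eigenspace-cong A y (≋-sym Pv≈w) ew
      where
      Pv≈w : mulVec ℝ P v ≋ w
      Pv≈w i = begin
        mulVec ℝ P v i
          ≈⟨ mulVec-spectralProjection v i ⟩
        r * (mulVec ℝ A v i - x * v i)
          ≈⟨ *-congˡ (+-cong Av (-‿cong (*-congˡ (v≈u+w i)))) ⟩
        r * (x * u i + y * w i - x * (u i + w i))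
          ≈⟨ solve 5 (λ r x y u w → r :* (x :* u :+ y :* w :- x :* (u :+ w)) := (y :- x) :* r :* w) refl r x y (u i) (w i) ⟩
        (y - x) * r * w i
          ≈⟨ trans (*-congʳ y-x-inverse) (*-identityˡ (w i)) ⟩
        w i ∎
        where
        Av : mulVec ℝ A v i ≈ x * u i + y * w i
        Av = begin
          mulVec ℝ A v i                                    ≈⟨ mulVec-cong A v≈u+w i ⟩
          mulVec ℝ A (λ i → u i + w i) i                    ≈⟨ mulVec-cong A (λ i → +-cong (sym (*-identityˡ (u i))) (sym (*-identityˡ (w i)))) i ⟩
          mulVec ℝ A (λ i → 1# * u i + 1# * w i) i          ≈⟨ dot-linearʳ (A i) 1# 1# u w ⟩
          1# * mulVec ℝ A u i + 1# * mulVec ℝ A w i         ≈⟨ +-cong (trans (*-identityˡ _) (eu i)) (trans (*-identityˡ _) (ew i)) ⟩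
          x * u i + y * w i                                 ∎

    spectralProjection-fixes : ∀ {v} → Eigenspace ℝ A y v → mulVec ℝ P v ≋ v
    spectralProjection-fixes {v} ev i = begin
      mulVec ℝ P v i                     ≈⟨ mulVec-spectralProjection v i ⟩
      r * (mulVec ℝ A v i - x * v i)     ≈⟨ *-congˡ (+-congʳ (ev i)) ⟩
      r * (y * v i - x * v i)            ≈⟨ solve 4 (λ r x y v → r :* (y :* v :- x :* v) := (y :- x) :* r :* v) refl r x y (v i) ⟩
      (y - x) * r * v i                  ≈⟨ trans (*-congʳ y-x-inverse) (*-identityˡ (v i)) ⟩
      v i                                ∎

    spectralProjection-column : ∀ j → Eigenspace ℝ A y (λ i → P i j)
    spectralProjection-column j = eigenspace-cong A y (mulVec-unit P j) (spectralProjection-image (unit j))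

    spectralProjection-isOrthogonalProjection : IsOrthogonalProjection ℝ P
    spectralProjection-isOrthogonalProjection = record
      { symmetric  = λ i j → *-congˡ (shift-sym {A = A} x symmetric i j)
      -- Each column of P lies in the eigenspace at y, where P acts as the identity.
      ; idempotent = λ i j → spectralProjection-fixes (spectralProjection-column j) i
      }

    -- Off the diagonal P is r A, and r is nonzero, being the inverse of y - x.
    spectralProjection-realizes : ∀ {G} → Realizes ℝ G A → Realizes ℝ G P
    spectralProjection-realizes realizes = record
      { symmetric = λ i j → *-congˡ (shift-sym {A = A} x symmetric i j)
      ; pattern-⇔ = λ i j i≢j → mk⇔
          (λ Pij≉0 → Equivalence.to (pattern-⇔ i j i≢j) λ Aij≈0 →
            Pij≉0 (trans (*-congˡ (trans (offDiagonal i≢j) Aij≈0)) (zeroʳ r)))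
          (λ adj → *-≉0 r≉0 λ shift≈0 →
            Equivalence.from (pattern-⇔ i j i≢j) adj (trans (sym (offDiagonal i≢j)) shift≈0))
      }
      where
      open Realizes realizes using (pattern-⇔)

      r≉0 : r ≉ 0#
      r≉0 r≈0 = 0≉1 (trans (sym (trans (*-congˡ r≈0) (zeroʳ (y - x)))) y-x-inverse)

      offDiagonal : ∀ {i j} → i ≢ j → shift A x i j ≈ A i j
      offDiagonal {i} {j} i≢j = trans (+-congˡ (-‿cong (*-congˡ (unit-≢ i≢j))))
        (solve 2 (λ a x → a :- x :* con (+ 0) := a) refl (A i j) x)

  -- The k basis vectors of the second eigenspace span the columns of the projection onto it, so the
  -- column bound applies directly.
  achievable⇒≥3 : ∀ {n k} → Achievable ℝ (complement (path (5 ℕ.+ n))) k → 3 ℕ.≤ k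
  achievable⇒≥3 {n} {k} (_ , k≤⌊n/2⌋ , A , realizes , e , spectrum , mult₀ , mult₁@(b , isB)) =
    let r , eq = inverse y-x≉0
        symmetric = Realizes.symmetric realizes
    in column-rank≥3 (spectralProjection-realizes symmetric eq span realizes)
                     (spectralProjection-isOrthogonalProjection symmetric eq span)
                     b
                     (λ j → IsBasis.spanning isB _ (spectralProjection-column symmetric eq span j))
    where
    x = e zero
    y = e (suc zero)

    x≉y : x ≉ y
    x≉y x≈y with () ← DistinctEigenvalues.distinct spectrum x≈y

    y-x≉0 : y - x ≉ 0#
    y-x≉0 y-x≈0 = x≉y (sym (x∙y⁻¹≈ε⇒x≈y y x y-x≈0))

    -- As k is at most half the number of vertices, the subtraction in the first multiplicity is not
    -- truncated, and the multiplicities add up to the full dimension.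
    span = eigenspaces-span A x≉y
      (ℕ.≤-reflexive (≡.sym (ℕ.m∸n+n≡m (ℕ.≤-trans k≤⌊n/2⌋ (ℕ.⌊n/2⌋≤n _))))) mult₀ mult₁

-- The projection onto the span of orthonormal vectors: rank and spectrum

module Orthonormal {c ℓ₁ ℓ₂} (ℝ : RealNumbers c ℓ₁ ℓ₂) where
  open OrderedField ℝ
  open LinearAlgebra ℝ
  open import Relation.Binary.Reasoning.Setoid setoid

  IsOrthonormal : ∀ {n k} → Vector (Vector Carrier n) k → Set ℓ₁
  IsOrthonormal c = ∀ a b → dot (c a) (c b) ≈ unit a b

  -- One hyperplane is cut off per vector. The first vector lies in the complement of the others and
  -- is not orthogonal to itself, so each cut lowers the dimension by exactly one.
  orthogonalComplement-dimension : ∀ {n k} o → k ℕ.+ o ≡ n → (c : Vector (Vector Carrier n) k) → IsOrthonormal c →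
                                   HasDimension ℝ (λ v → ∀ a → dot (c a) v ≈ 0#) o
  orthogonalComplement-dimension {k = zero}  o ≡.refl c _ = units-basis (λ _ ())
  orthogonalComplement-dimension {n} {k = suc k} o k+o≡n  c orthonormal = hasDimension-resp-⇔
    (λ { (rest , first) zero → first ; (rest , first) (suc a) → rest a })
    (λ ⊥c → (⊥c ∘ suc) , ⊥c zero)
    (hyperplane-dimension closed (c zero) {c zero} (λ a → orthonormal (suc a) zero)
      (λ c₀c₀≈0 → 0≉1 (trans (sym c₀c₀≈0) (orthonormal zero zero)))
      (orthogonalComplement-dimension (suc o) (≡.trans (ℕ.+-suc k o) k+o≡n) (c ∘ suc) (λ a b → orthonormal (suc a) (suc b))))
    where
    closed : ∀ a b {x y : Vector Carrier n} → (∀ i → dot (c (suc i)) x ≈ 0#) → (∀ i → dot (c (suc i)) y ≈ 0#) →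
             ∀ i → dot (c (suc i)) (λ j → a * x j + b * y j) ≈ 0#
    closed a b {x} {y} x⊥ y⊥ i = trans (dot-linearʳ (c (suc i)) a b x y)
      (trans (+-cong (trans (*-congˡ (x⊥ i)) (zeroʳ a)) (trans (*-congˡ (y⊥ i)) (zeroʳ b))) (+-identityˡ 0#))

  nonzero-member : ∀ {n m p} {S : Vector Carrier n → Set p} → HasDimension ℝ S (suc m) → ∃[ v ] ¬ IsZero v × S v
  nonzero-member (b , isB) = b zero , (λ b₀≈0 → unit-≉0 zero (IsBasis.independent isB (unit zero)
      (λ i → trans (sum-cong-≋ (λ j → *-comm (unit zero j) (b j i))) (trans (sum-unit (λ j → b j i) zero) (b₀≈0 i)))))
    , IsBasis.member isB zero

  module Projection {n k} (c : Vector (Vector Carrier n) k) (orthonormal : IsOrthonormal c) where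
    -- For the k × n matrix C with rows `c a` this is CᵀC: orthonormal rows make it a projection,
    -- while its entries are the inner products of the columns of C.
    P : Matrix ℝ n
    P i j = sum (λ a → c a i * c a j)

    coordinates : Vector Carrier n → Vector Carrier k
    coordinates v a = dot (c a) v

    mulVec-P : ∀ v → mulVec ℝ P v ≋ combination ℝ (coordinates v) c
    mulVec-P v i = begin
      sum (λ j → sum (λ a → c a i * c a j) * v j)     ≈⟨ combination-assoc {n = 1} (λ a → c a i) c (λ j _ → v j) zero ⟨
      sum (λ a → c a i * dot (c a) v)                 ≈⟨ sum-cong-≋ (λ a → *-comm (c a i) (dot (c a) v)) ⟩
      combination ℝ (coordinates v) c i               ∎

    coordinates-combination : ∀ z a → coordinates (combination ℝ z c) a ≈ z a
    coordinates-combination z a = trans (dot-combination (c a) z c)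
      (trans (sum-cong-≋ (λ b → *-congˡ (orthonormal a b))) (sum-unit z a))

    P-fixes : ∀ z → mulVec ℝ P (combination ℝ z c) ≋ combination ℝ z c
    P-fixes z i = trans (mulVec-P (combination ℝ z c) i)
      (combination-cong {b = c} (coordinates-combination z) (λ _ → ≋-refl) i)

    P-idempotent : ∀ v → mulVec ℝ P (mulVec ℝ P v) ≋ mulVec ℝ P v
    P-idempotent v i = trans (mulVec-cong P (mulVec-P v) i) (trans (P-fixes (coordinates v) i) (sym (mulVec-P v i)))

    P-basis : ∀ a → mulVec ℝ P (c a) ≋ c a
    P-basis a i = begin
      mulVec ℝ P (c a) i                        ≈⟨ mulVec-P (c a) i ⟩
      sum (λ b → dot (c b) (c a) * c b i)       ≈⟨ sum-cong-≋ (λ b → trans (*-comm _ (c b i))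
                                                     (*-congˡ (trans (orthonormal b a) (unit-sym b a)))) ⟩
      sum (λ b → c b i * unit a b)              ≈⟨ sum-unit (λ b → c b i) a ⟩
      c a i                                     ∎

    P-symmetric : IsSymmetric ℝ P
    P-symmetric i j = sum-cong-≋ (λ a → *-comm (c a i) (c a j))

    isOrthogonalProjection : IsOrthogonalProjection ℝ P
    isOrthogonalProjection = record
      { symmetric  = P-symmetric
      ; idempotent = λ i j → trans (mulVec-cong P (λ k → sym (mulVec-unit P j k)) i)
          (trans (P-idempotent (unit j) i) (mulVec-unit P j i))
      }

    independent : ∀ z → IsZero (combination ℝ z c) → IsZero z
    independent z zc≈0 a = trans (sym (coordinates-combination z a))
      (sum-zero (λ i → trans (*-congˡ (zc≈0 i)) (zeroʳ (c a i))))

    hasRank : HasRank ℝ P k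
    hasRank = c , record
      { member      = λ a → c a , P-basis a
      ; independent = independent
      ; spanning    = λ v (x , Px≋v) → coordinates x , λ i → trans (sym (Px≋v i)) (mulVec-P x i)
      }

    multiplicity-1 : HasMultiplicity ℝ P 1# k
    multiplicity-1 = c , record
      { member      = λ a i → trans (P-basis a i) (sym (*-identityˡ (c a i)))
      ; independent = independent
      ; spanning    = λ v ev → coordinates v , λ i →
          trans (sym (trans (ev i) (*-identityˡ (v i)))) (mulVec-P v i)
      }

    multiplicity-0 : ∀ {o} → k ℕ.+ o ≡ n → HasMultiplicity ℝ P 0# o
    multiplicity-0 {o} k+o≡n = hasDimension-resp-⇔
      (λ {v} ⊥c i → trans (mulVec-P v i)
        (trans (sum-zero (λ a → trans (*-congʳ (⊥c a)) (zeroˡ (c a i)))) (sym (zeroˡ (v i)))))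
      (λ {v} ev → independent (coordinates v) (λ i → trans (sym (mulVec-P v i)) (trans (ev i) (zeroˡ (v i)))))
      (orthogonalComplement-dimension o k+o≡n c orthonormal)

    spectrum : Fin 2 → Carrier
    spectrum zero       = 0#
    spectrum (suc zero) = 1#

    -- Both multiplicities are positive here, so each of 0 and 1 has an eigenvector. No further
    -- eigenvalue occurs, since P² = P gives x (1 - x) v = 0.
    distinctEigenvalues : ∀ {k′ o} → k ≡ suc k′ → k ℕ.+ suc o ≡ n → DistinctEigenvalues ℝ P spectrum
    distinctEigenvalues ≡.refl k+o≡n = record
      { distinct    = distinct
      ; eigenvalues = λ where
          zero       → eigenvalue (nonzero-member (multiplicity-0 k+o≡n))
          (suc zero) → eigenvalue (nonzero-member multiplicity-1)
      ; exhaustive  = exhaustive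
      }
      where
      distinct : ∀ {i j} → spectrum i ≈ spectrum j → i ≡ j
      distinct {zero}     {zero}     _   = ≡.refl
      distinct {zero}     {suc zero} 0≈1 = contradiction 0≈1 0≉1
      distinct {suc zero} {zero}     1≈0 = contradiction (sym 1≈0) 0≉1
      distinct {suc zero} {suc zero} _   = ≡.refl

      eigenvalue : ∀ {x} → (∃[ v ] ¬ IsZero v × Eigenspace ℝ P x v) → IsEigenvalue ℝ P x
      eigenvalue (v , v≉0 , ev) = v , v≉0 , ev

      exhaustive : ∀ x → IsEigenvalue ℝ P x → ∃[ i ] spectrum i ≈ x
      exhaustive x (v , v≉0 , ev) with 0# ≟ x | 1# ≟ x
      ... | yes 0≈x | _       = zero , 0≈x
      ... | no  _   | yes 1≈x = suc zero , 1≈x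
      ... | no  0≉x | no  1≉x = contradiction v≈0 v≉0
        where
        x²v≈xv : ∀ i → x * (x * v i) ≈ x * v i
        x²v≈xv i = begin
          x * (x * v i)                     ≈⟨ *-congˡ (ev i) ⟨
          x * mulVec ℝ P v i                ≈⟨ *-distribˡ-sum x (λ j → P i j * v j) ⟩
          sum (λ j → x * (P i j * v j))     ≈⟨ sum-cong-≋ (λ j → solve 3 (λ x p v → x :* (p :* v) := p :* (x :* v)) refl x (P i j) (v j)) ⟩
          mulVec ℝ P (λ j → x * v j) i      ≈⟨ mulVec-cong P ev i ⟨
          mulVec ℝ P (mulVec ℝ P v) i       ≈⟨ P-idempotent v i ⟩
          mulVec ℝ P v i                    ≈⟨ ev i ⟩
          x * v i                           ∎

        v≈0 : IsZero v
        v≈0 i = *-cancelˡ-0 (λ 1-x≈0 → 1≉x (x∙y⁻¹≈ε⇒x≈y 1# x 1-x≈0)) (*-cancelˡ-0 (λ x≈0 → 0≉x (sym x≈0)) (begin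
          x * ((1# - x) * v i)          ≈⟨ solve 2 (λ x v → x :* ((con (+ 1) :- x) :* v) := x :* v :- x :* (x :* v)) refl x (v i) ⟩
          x * v i - x * (x * v i)       ≈⟨ x≈y⇒x∙y⁻¹≈ε (sym (x²v≈xv i)) ⟩
          0#                            ∎))

-- Generic vectors and cross products in three dimensions

module GenericVectors {c ℓ₁ ℓ₂} (ℝ : RealNumbers c ℓ₁ ℓ₂) where
  open OrderedField ℝ
  open LinearAlgebra ℝ
  open import Relation.Binary.Reasoning.Setoid setoid

  x<x+1 : ∀ x → x < x + 1#
  x<x+1 x = 0<-⇒< (<-respʳ-≈ (solve 1 (λ x → con (+ 1) := x :+ con (+ 1) :- x) refl x) 0<1)

  strictUpperBound : ∀ {m} (T : Vector Carrier m) → ∃[ t ] (∀ i → T i < t)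
  strictUpperBound {zero}  T = 0# , λ ()
  strictUpperBound {suc m} T = larger (strictUpperBound (T ∘ suc))
    where
    larger : ∃[ t ] (∀ i → T (suc i) < t) → ∃[ t ] (∀ i → T i < t)
    larger (t , T<t) with compare (T zero) t
    ... | tri< T₀<t _ _ = t , λ { zero → T₀<t ; (suc i) → T<t i }
    ... | tri≈ _ T₀≈t _ = T zero + 1# , λ { zero → x<x+1 _ ; (suc i) → <-trans (<-respʳ-≈ (sym T₀≈t) (T<t i)) (x<x+1 _) }
    ... | tri> _ _ t<T₀ = T zero + 1# , λ { zero → x<x+1 _ ; (suc i) → <-trans (<-trans (T<t i) t<T₀) (x<x+1 _) }

  -- T is the root of the affine function if q ≠ 0, and arbitrary otherwise. Thresholds are
  -- convenient because finitely many of them are passed at once by an upper bound.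
  affine-threshold : ∀ p q → ∃[ T ] (∀ t → T < t → p + t * q ≈ 0# → p ≈ 0# × q ≈ 0#)
  affine-threshold p q with q ≟ 0#
  ... | yes q≈0 = 0# , λ t _ eq → trans (sym (trans (+-congˡ (trans (*-congˡ q≈0) (zeroʳ t))) (+-identityʳ p))) eq , q≈0
  ... | no  q≉0 = let r , qr≈1 = inverse q≉0 in - (p * r) , λ t T<t eq → contradiction T<t (irrefl (begin
    - (p * r)                      ≈⟨ solve 4 (λ p q r t → :- (p :* r) := t :* (q :* r) :- (p :+ t :* q) :* r) refl p q r t ⟩
    t * (q * r) - (p + t * q) * r  ≈⟨ +-cong (*-congˡ qr≈1) (-‿cong (*-congʳ eq)) ⟩
    t * 1# - 0# * r                ≈⟨ solve 2 (λ t r → t :* con (+ 1) :- con (+ 0) :* r := t) refl t r ⟩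
    t                              ∎))

  affine-generic : ∀ {m} (p q : Vector Carrier m) → ∃[ t ] (∀ i → p i + t * q i ≈ 0# → p i ≈ 0# × q i ≈ 0#)
  affine-generic p q =
    let t , T<t = strictUpperBound (λ i → proj₁ (affine-threshold (p i) (q i)))
    in t , λ i → proj₂ (affine-threshold (p i) (q i)) t (T<t i)

  Vector₃ : Set c
  Vector₃ = Vector Carrier 3

  pattern 0F = zero
  pattern 1F = suc zero
  pattern 2F = suc (suc zero)

  vec : Carrier → Carrier → Carrier → Vector₃
  vec x y z 0F = x
  vec x y z 1F = y
  vec x y z 2F = z

  -- For w = (1, s, s t) the product is w · z = z₀ + s (z₁ + t z₂), a nested affine function: t is
  -- chosen generic for the inner one, then s for the outer one.
  generic-vector : ∀ {m} (z : Vector Vector₃ m) → (∀ i → ¬ IsZero (z i)) → ∃[ w ] (∀ i → dot w (z i) ≉ 0#)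
  generic-vector z z≉0 =
    let t , t-generic = affine-generic (λ i → z i 1F) (λ i → z i 2F)
        s , s-generic = affine-generic (λ i → z i 0F) (λ i → z i 1F + t * z i 2F)
    in vec 1# s (s * t) , λ i wz≈0 → z≉0 i (components s t (z i) (s-generic i) (t-generic i) wz≈0)
    where
    components : ∀ s t (z : Vector₃) →
                 (z 0F + s * (z 1F + t * z 2F) ≈ 0# → z 0F ≈ 0# × z 1F + t * z 2F ≈ 0#) →
                 (z 1F + t * z 2F ≈ 0# → z 1F ≈ 0# × z 2F ≈ 0#) →
                 dot (vec 1# s (s * t)) z ≈ 0# → IsZero z
    components s t z s-generic t-generic wz≈0 =
      let z₀≈0 , rest  = s-generic (trans
            (solve 5 (λ s t x y z → x :+ s :* (y :+ t :* z) := con (+ 1) :* x :+ (s :* y :+ (s :* t :* z :+ con (+ 0))))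
              refl s t (z 0F) (z 1F) (z 2F)) wz≈0)
          z₁≈0 , z₂≈0 = t-generic rest
      in λ { 0F → z₀≈0 ; 1F → z₁≈0 ; 2F → z₂≈0 }

  cross : Vector₃ → Vector₃ → Vector₃
  cross x y = vec (x 1F * y 2F - x 2F * y 1F) (x 2F * y 0F - x 0F * y 2F) (x 0F * y 1F - x 1F * y 0F)

  cross-orthogonal : ∀ x y → dot (cross x y) x ≈ 0#
  cross-orthogonal x y = solve 6 (λ x₀ x₁ x₂ y₀ y₁ y₂ →
      (x₁ :* y₂ :- x₂ :* y₁) :* x₀ :+ ((x₂ :* y₀ :- x₀ :* y₂) :* x₁ :+ ((x₀ :* y₁ :- x₁ :* y₀) :* x₂ :+ con (+ 0))) := con (+ 0))
    refl (x 0F) (x 1F) (x 2F) (y 0F) (y 1F) (y 2F)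

  triple-product : ∀ x y z → dot (cross x y) z ≈ dot y (cross z x)
  triple-product x y z = solve 9 (λ x₀ x₁ x₂ y₀ y₁ y₂ z₀ z₁ z₂ →
      (x₁ :* y₂ :- x₂ :* y₁) :* z₀ :+ ((x₂ :* y₀ :- x₀ :* y₂) :* z₁ :+ ((x₀ :* y₁ :- x₁ :* y₀) :* z₂ :+ con (+ 0)))
      := y₀ :* (z₁ :* x₂ :- z₂ :* x₁) :+ (y₁ :* (z₂ :* x₀ :- z₀ :* x₂) :+ (y₂ :* (z₀ :* x₁ :- z₁ :* x₀) :+ con (+ 0))))
    refl (x 0F) (x 1F) (x 2F) (y 0F) (y 1F) (y 2F) (z 0F) (z 1F) (z 2F)

-- Weighted vector configurations and their extension by one vector

module Configurations {c ℓ₁ ℓ₂} (ℝ : RealNumbers c ℓ₁ ℓ₂) where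
  open OrderedField ℝ
  open LinearAlgebra ℝ
  open Spectral ℝ using (dot-definite)
  open GenericVectors ℝ
  open import Relation.Binary.Reasoning.Setoid setoid

  -- Only coordinate 0 is expanded; the other two follow by cyclic permutation of the coordinates,
  -- after reordering the terms of the dot products.
  double-cross : ∀ x y z i → cross (cross x y) z i ≈ y i * dot x z - x i * dot y z
  double-cross x y z = λ where
      0F → identity (x 0F) (x 1F) (x 2F) (y 0F) (y 1F) (y 2F) (z 0F) (z 1F) (z 2F)
      1F → trans (identity (x 1F) (x 2F) (x 0F) (y 1F) (y 2F) (y 0F) (z 1F) (z 2F) (z 0F))
                 (rotated (x 1F) (y 1F) (rotate x z) (rotate y z))
      2F → trans (identity (x 2F) (x 0F) (x 1F) (y 2F) (y 0F) (y 1F) (z 2F) (z 0F) (z 1F))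
                 (rotated (x 2F) (y 2F) (rotate² x z) (rotate² y z))
    where
    identity : ∀ x₀ x₁ x₂ y₀ y₁ y₂ z₀ z₁ z₂ →
      (x₂ * y₀ - x₀ * y₂) * z₂ - (x₀ * y₁ - x₁ * y₀) * z₁ ≈
      y₀ * (x₀ * z₀ + (x₁ * z₁ + (x₂ * z₂ + 0#))) - x₀ * (y₀ * z₀ + (y₁ * z₁ + (y₂ * z₂ + 0#)))
    identity = solve 9 (λ x₀ x₁ x₂ y₀ y₁ y₂ z₀ z₁ z₂ →
      (x₂ :* y₀ :- x₀ :* y₂) :* z₂ :- (x₀ :* y₁ :- x₁ :* y₀) :* z₁ :=
      y₀ :* (x₀ :* z₀ :+ (x₁ :* z₁ :+ (x₂ :* z₂ :+ con (+ 0)))) :- x₀ :* (y₀ :* z₀ :+ (y₁ :* z₁ :+ (y₂ :* z₂ :+ con (+ 0))))) refl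

    cycle : ∀ p q r → p + (q + (r + 0#)) ≈ r + (p + (q + 0#))
    cycle = solve 3 (λ p q r → p :+ (q :+ (r :+ con (+ 0))) := r :+ (p :+ (q :+ con (+ 0)))) refl

    rotate : ∀ (x z : Vector₃) → x 1F * z 1F + (x 2F * z 2F + (x 0F * z 0F + 0#)) ≈ dot x z
    rotate x z = cycle (x 1F * z 1F) (x 2F * z 2F) (x 0F * z 0F)

    rotate² : ∀ (x z : Vector₃) → x 2F * z 2F + (x 0F * z 0F + (x 1F * z 1F + 0#)) ≈ dot x z
    rotate² x z = trans (cycle (x 2F * z 2F) (x 0F * z 0F) (x 1F * z 1F)) (cycle (x 1F * z 1F) (x 2F * z 2F) (x 0F * z 0F))

    rotated : ∀ a b {d d′ e e′} → d ≈ d′ → e ≈ e′ → b * d - a * e ≈ b * d′ - a * e′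
    rotated a b d≈ e≈ = +-cong (*-congˡ d≈) (-‿cong (*-congˡ e≈))

  cross-proportional : ∀ {x y : Vector₃} δ ε → (∀ i → y i * δ ≈ x i * ε) → ∀ i → δ * cross x y i ≈ 0#
  cross-proportional {x} {y} δ ε eq = λ { 0F → minor 1F 2F ; 1F → minor 2F 0F ; 2F → minor 0F 1F }
    where
    minor : ∀ i j → δ * (x i * y j - x j * y i) ≈ 0#
    minor i j = begin
      δ * (x i * y j - x j * y i)             ≈⟨ solve 5 (λ δ a b c d → δ :* (a :* d :- b :* c) := a :* (d :* δ) :- b :* (c :* δ))
                                                   refl δ (x i) (x j) (y i) (y j) ⟩
      x i * (y j * δ) - x j * (y i * δ)       ≈⟨ +-cong (*-congˡ (eq j)) (-‿cong (*-congˡ (eq i))) ⟩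
      x i * (x j * ε) - x j * (x i * ε)       ≈⟨ solve 3 (λ a b ε → a :* (b :* ε) :- b :* (a :* ε) := con (+ 0)) refl (x i) (x j) ε ⟩
      0#                                      ∎

  zero-cross : ∀ {x} y → IsZero x → IsZero (cross x y)
  zero-cross {x} y x≈0 = λ { 0F → minor 1F 2F ; 1F → minor 2F 0F ; 2F → minor 0F 1F }
    where
    minor : ∀ i j → x i * y j - x j * y i ≈ 0#
    minor i j = trans (+-cong (trans (*-congʳ (x≈0 i)) (zeroˡ (y j))) (-‿cong (trans (*-congʳ (x≈0 j)) (zeroˡ (y i)))))
                      (-‿inverseʳ 0#)

  -- gram w u a b is the (a,b) entry of Σᵢ wᵢ uᵢ uᵢᵀ.
  gram : ∀ {n} → Vector Carrier n → Vector Vector₃ n → Fin 3 → Fin 3 → Carrier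
  gram w u a b = sum (λ i → w i * (u i a * u i b))

  -- The last field says that the uᵢ uᵢᵀ span the symmetric matrices, so that
  -- the weights can be perturbed when a vector is added.
  record Configuration {n} (u : Vector Vector₃ (2 ℕ.+ n)) : Set (c ⊔ ℓ₁ ⊔ ℓ₂) where
    field
      orthogonal    : ∀ i j → suc (toℕ i) ≡ toℕ j → dot (u i) (u j) ≈ 0#
      nonorthogonal : ∀ i j → suc (toℕ i) ℕ.< toℕ j → dot (u i) (u j) ≉ 0#
      nonparallel   : ∀ j → ¬ IsZero (cross (u zero) (u (suc j)))
      size          : Carrier
      size-pos      : 0# < size
      weight        : Vector Carrier (2 ℕ.+ n)
      weight-pos    : ∀ i → 0# < weight i
      tight         : ∀ a b → gram weight u a b ≈ size * unit a b
      full          : ∀ (x : Vector₃) → ∃[ d ] ∃[ α ] 0# < d × (∀ a b → gram α u a b ≈ d * (x a * x b))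

  module Extension {n} {u : Vector Vector₃ (2 ℕ.+ n)} (config : Configuration u) where
    open Configuration config

    -- The cross products keep the new vector from being orthogonal to later ones; `u (suc zero)`
    -- keeps it from being parallel to `u (suc zero)`.
    avoided : Vector Vector₃ (2 ℕ.+ n)
    avoided zero    = u (suc zero)
    avoided (suc j) = cross (u (suc j)) (u zero)

    swap-cross : ∀ x y → IsZero (cross x y) → IsZero (cross y x)
    swap-cross x y z = λ { 0F → minor 1F 2F (z 0F) ; 1F → minor 2F 0F (z 1F) ; 2F → minor 0F 1F (z 2F) }
      where
      minor : ∀ i j → x i * y j - x j * y i ≈ 0# → y i * x j - y j * x i ≈ 0#
      minor i j eq = trans (solve 4 (λ a b c d → b :* c :- d :* a := :- (a :* d :- c :* b)) refl (x i) (y i) (x j) (y j))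
        (trans (-‿cong eq) -0#≈0#)

    avoided-≉0 : ∀ j → ¬ IsZero (avoided j)
    avoided-≉0 zero    u₁≈0 = nonparallel zero (swap-cross (u (suc zero)) (u zero) (zero-cross (u zero) u₁≈0))
    avoided-≉0 (suc j) eq   = nonparallel j (swap-cross (u (suc j)) (u zero) eq)

    w : Vector₃
    w = proj₁ (generic-vector avoided avoided-≉0)

    w-generic : ∀ j → dot w (avoided j) ≉ 0#
    w-generic = proj₂ (generic-vector avoided avoided-≉0)

    new : Vector₃
    new = cross (u zero) w

    new-nonorthogonal : ∀ j → dot new (u (suc j)) ≉ 0#
    new-nonorthogonal j eq = w-generic (suc j) (trans (sym (triple-product (u zero) w (u (suc j)))) eq)

    new-≉0 : ¬ IsZero new
    new-≉0 new≈0 = new-nonorthogonal zero (sum-zero (λ i → trans (*-congʳ (new≈0 i)) (zeroˡ (u (suc zero) i))))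

    u₀≉0 : ¬ IsZero (u zero)
    u₀≉0 u₀≈0 = nonparallel zero (zero-cross (u (suc zero)) u₀≈0)

    -- If (u₀ × w) × uⱼ = w (u₀ · uⱼ) - u₀ (w · uⱼ) were zero, then w would be a multiple of u₀ and
    -- `new` would vanish.
    nonparallel-if : ∀ j → dot (u zero) (u j) ≉ 0# → ¬ IsZero (cross new (u j))
    nonparallel-if j u₀uⱼ≉0 eq = new-≉0 λ i → *-cancelˡ-0 u₀uⱼ≉0
      (cross-proportional (dot (u zero) (u j)) (dot w (u j))
        (λ i → x∙y⁻¹≈ε⇒x≈y _ _ (trans (sym (double-cross (u zero) w (u j) i)) (eq i))) i)

    new-nonparallel : ∀ j → ¬ IsZero (cross new (u j))
    new-nonparallel zero          = nonparallel-if zero (λ eq → u₀≉0 (dot-definite {v = u zero} eq))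
    new-nonparallel (suc (suc j)) = nonparallel-if (suc (suc j)) (nonorthogonal zero (suc (suc j)) (ℕ.s≤s (ℕ.s≤s ℕ.z≤n)))
    -- Here u₀ · u₁ = 0, so the double cross product is just - u₀ (w · u₁), and w was chosen with w
    -- · u₁ ≠ 0.
    new-nonparallel (suc zero) eq = u₀≉0 λ i → *-cancelˡ-0 (w-generic zero) (begin
      dot w u₁ * u zero i
        ≈⟨ solve 3 (λ d x y → d :* x := :- (y :* con (+ 0) :- x :* d)) refl (dot w u₁) (u zero i) (w i) ⟩
      - (w i * 0# - u zero i * dot w u₁)
        ≈⟨ -‿cong (+-congʳ (*-congˡ (orthogonal zero (suc zero) ≡.refl))) ⟨
      - (w i * dot (u zero) u₁ - u zero i * dot w u₁)
        ≈⟨ -‿cong (double-cross (u zero) w u₁ i) ⟨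
      - cross new u₁ i
        ≈⟨ trans (-‿cong (eq i)) -0#≈0# ⟩
      0# ∎)
      where
      u₁ = u (suc zero)

    gram-combination : ∀ t (v α : Vector Carrier (2 ℕ.+ n)) a b →
                       gram (λ i → t * v i - α i) u a b ≈ t * gram v u a b - gram α u a b
    gram-combination t v α a b = begin
      sum (λ i → (t * v i - α i) * (u i a * u i b))
        ≈⟨ sum-cong-≋ (λ i → solve 4 (λ t v α p → (t :* v :- α) :* p := t :* (v :* p) :+ (:- con (+ 1)) :* (α :* p))
                               refl t (v i) (α i) (u i a * u i b)) ⟩
      sum (λ i → t * (v i * (u i a * u i b)) + - 1# * (α i * (u i a * u i b)))
        ≈⟨ sum-linear t (- 1#) (λ i → v i * (u i a * u i b)) (λ i → α i * (u i a * u i b)) ⟩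
      t * gram v u a b + - 1# * gram α u a b
        ≈⟨ solve 3 (λ t g h → t :* g :+ (:- con (+ 1)) :* h := t :* g :- h) refl t (gram v u a b) (gram α u a b) ⟩
      t * gram v u a b - gram α u a b ∎

    large-multiple : ∀ (α : Vector Carrier (2 ℕ.+ n)) → ∃[ t ] 0# < t × (∀ i → 0# < t * weight i - α i)
    large-multiple α =
      -- t has to exceed every quotient of αᵢ by the weight; the entry `0#` makes t positive as
      -- well.
      let t , T<t = strictUpperBound (0# ◂ λ i → α i * proj₁ (inverse-pos (weight-pos i)))
      in t , T<t zero , λ i → dominates i (proj₂ (inverse-pos (weight-pos i))) (T<t (suc i))
      where
      dominates : ∀ i {r t} → 0# < r × weight i * r ≈ 1# → α i * r < t → 0# < t * weight i - α i
      dominates i {r} {t} (_ , wr≈1) αr<t = <⇒0<- (<-respˡ-≈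
        (trans (solve 3 (λ w a r → w :* (a :* r) := a :* (w :* r)) refl (weight i) (α i) r)
               (trans (*-congˡ wr≈1) (*-identityʳ (α i))))
        (<-respʳ-≈ (*-comm (weight i) t) (*-mono-< (weight-pos i) αr<t)))

    -- Instead of making the new weight small, everything else is scaled up by t: the new vector
    -- gets weight d, and subtracting α from the old weights removes exactly its contribution.
    extended : Configuration (new ◂ u)
    extended =
      let d , α , 0<d , α-new  = full new
          t , 0<t , dominates  = large-multiple α
      in record
      { orthogonal    = orthogonal′
      ; nonorthogonal = nonorthogonal′
      ; nonparallel   = new-nonparallel
      ; size          = t * size
      ; size-pos      = *-pos 0<t size-pos
      ; weight        = d ◂ (λ i → t * weight i - α i)
      ; weight-pos    = λ { zero → 0<d ; (suc i) → dominates i }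
      ; tight         = λ a b → tight′ a b t α (α-new a b)
      ; full          = λ x → let d , α , 0<d , α-x = full x in
                          d , 0# ◂ α , 0<d , λ a b → trans (ignore-new α a b) (α-x a b)
      }
      where
      orthogonal′ : ∀ i j → suc (toℕ i) ≡ toℕ j → dot ((new ◂ u) i) ((new ◂ u) j) ≈ 0#
      orthogonal′ zero    (suc zero)    _  = cross-orthogonal (u zero) w
      orthogonal′ zero    (suc (suc j)) ()
      orthogonal′ (suc i) (suc j)       eq = orthogonal i j (ℕ.suc-injective eq)

      nonorthogonal′ : ∀ i j → suc (toℕ i) ℕ.< toℕ j → dot ((new ◂ u) i) ((new ◂ u) j) ≉ 0#
      nonorthogonal′ zero    (suc zero)    (ℕ.s≤s ())
      nonorthogonal′ zero    (suc (suc j)) _            = new-nonorthogonal j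
      nonorthogonal′ (suc i) (suc j)       (ℕ.s≤s i+1<j) = nonorthogonal i j i+1<j

      ignore-new : ∀ α a b → 0# * (new a * new b) + gram α u a b ≈ gram α u a b
      ignore-new α a b = trans (+-congʳ (zeroˡ (new a * new b))) (+-identityˡ (gram α u a b))

      tight′ : ∀ a b {d} t α → gram α u a b ≈ d * (new a * new b) →
               d * (new a * new b) + gram (λ i → t * weight i - α i) u a b ≈ t * size * unit a b
      tight′ a b {d} t α α-new = begin
        d * (new a * new b) + gram (λ i → t * weight i - α i) u a b
          ≈⟨ +-congˡ (gram-combination t weight α a b) ⟩
        d * (new a * new b) + (t * gram weight u a b - gram α u a b)
          ≈⟨ +-congˡ (+-cong (*-congˡ (tight a b)) (-‿cong α-new)) ⟩
        d * (new a * new b) + (t * (size * unit a b) - d * (new a * new b))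
          ≈⟨ solve 4 (λ p t s e → p :+ (t :* (s :* e) :- p) := t :* s :* e) refl (d * (new a * new b)) t size (unit a b) ⟩
        t * size * unit a b ∎

  extend : ∀ {n} → ∃ (Configuration {n}) → ∃ (Configuration {suc n})
  extend (u , config) = _ , Extension.extended config

-- Six integral vectors to start from

module BaseVectors where
  -- Found by computer search.
  vectorsℤ : Fin 6 → Fin 3 → ℤ
  vectorsℤ i = lookup (lookup
    ( (+ 0 ∷ + 1      ∷ -[1+ 1 ] ∷ [])
    ∷ (+ 1 ∷ + 0      ∷ + 0      ∷ [])
    ∷ (+ 0 ∷ + 1      ∷ + 0      ∷ [])
    ∷ (+ 1 ∷ + 0      ∷ -[1+ 0 ] ∷ [])
    ∷ (+ 1 ∷ + 1      ∷ + 1      ∷ [])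
    ∷ (+ 1 ∷ -[1+ 0 ] ∷ + 0      ∷ [])
    ∷ []) i)

  -- The weight of vector i is suc (weightsℕ i).
  weightsℕ : Fin 6 → ℕ
  weightsℕ = lookup (0 ∷ 1 ∷ 2 ∷ 1 ∷ 1 ∷ 1 ∷ [])

  -- Row i holds the coefficients of x², y², z², xy, xz and yz in the
  -- coefficient of uᵢ uᵢᵀ in 8 (x,y,z) (x,y,z)ᵀ.
  coefficientsℤ : Fin 6 → Fin 6 → ℤ
  coefficientsℤ i = lookup (lookup
    ( (+ 0 ∷ + 0 ∷ + 1      ∷ + 0      ∷ + 1      ∷ -[1+ 1 ]  ∷ [])
    ∷ (+ 8 ∷ + 0 ∷ -[1+ 5 ] ∷ + 8      ∷ + 2      ∷ -[1+ 11 ] ∷ [])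
    ∷ (+ 0 ∷ + 8 ∷ -[1+ 4 ] ∷ + 8      ∷ -[1+ 4 ] ∷ -[1+ 5 ]  ∷ [])
    ∷ (+ 0 ∷ + 0 ∷ + 2      ∷ + 0      ∷ -[1+ 5 ] ∷ + 4       ∷ [])
    ∷ (+ 0 ∷ + 0 ∷ + 2      ∷ + 0      ∷ + 2      ∷ + 4       ∷ [])
    ∷ (+ 0 ∷ + 0 ∷ + 2      ∷ -[1+ 7 ] ∷ + 2      ∷ + 4       ∷ [])
    ∷ []) i)

  dotℤ : (Fin 3 → ℤ) → (Fin 3 → ℤ) → ℤ
  dotℤ x y = foldr ℤ._+_ (+ 0) (λ a → x a ℤ.* y a)

  minorℤ : (Fin 3 → ℤ) → (Fin 3 → ℤ) → Fin 3 → Fin 3 → ℤ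
  minorℤ x y a b = x a ℤ.* y b ℤ.- x b ℤ.* y a

  crossℤ : (Fin 3 → ℤ) → (Fin 3 → ℤ) → Fin 3 → ℤ
  crossℤ x y zero             = minorℤ x y (suc zero) (suc (suc zero))
  crossℤ x y (suc zero)       = minorℤ x y (suc (suc zero)) zero
  crossℤ x y (suc (suc zero)) = minorℤ x y zero (suc zero)

  orthogonalℤ : ∀ i j → suc (toℕ i) ≡ toℕ j → dotℤ (vectorsℤ i) (vectorsℤ j) ≡ + 0
  orthogonalℤ = from-yes (Fin.all? λ i → Fin.all? λ j →
    (suc (toℕ i) ℕ.≟ toℕ j) →-dec (dotℤ (vectorsℤ i) (vectorsℤ j) ℤ.≟ + 0))

  nonorthogonalℤ : ∀ i j → suc (toℕ i) ℕ.< toℕ j → dotℤ (vectorsℤ i) (vectorsℤ j) ≢ + 0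
  nonorthogonalℤ = from-yes (Fin.all? λ i → Fin.all? λ j →
    (suc (toℕ i) ℕ.<? toℕ j) →-dec ¬? (dotℤ (vectorsℤ i) (vectorsℤ j) ℤ.≟ + 0))

  nonparallelℤ : ∀ j → ∃[ a ] crossℤ (vectorsℤ zero) (vectorsℤ (suc j)) a ≢ + 0
  nonparallelℤ = from-yes (Fin.all? λ j → Fin.any? λ a →
    ¬? (crossℤ (vectorsℤ zero) (vectorsℤ (suc j)) a ℤ.≟ + 0))

-- The initial configuration over the reals and all its extensions

module BaseConfiguration {c ℓ₁ ℓ₂} (ℝ : RealNumbers c ℓ₁ ℓ₂) where
  open OrderedField ℝ
  open LinearAlgebra ℝ
  open GenericVectors ℝ
  open Configurations ℝ
  open BaseVectors

  base : Vector Vector₃ 6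
  base i a = ι (vectorsℤ i a)

  ι-dot : ∀ {n} (x y : Fin n → ℤ) → dot (ι ∘ x) (ι ∘ y) ≈ ι (foldr ℤ._+_ (+ 0) (λ a → x a ℤ.* y a))
  ι-dot {zero}  x y = refl
  ι-dot {suc n} x y = sym (trans (ι-+ (x zero ℤ.* y zero) _) (+-cong (ι-* (x zero) (y zero)) (sym (ι-dot (x ∘ suc) (y ∘ suc)))))

  ι-cross : ∀ x y a → ι (crossℤ x y a) ≈ cross (ι ∘ x) (ι ∘ y) a
  ι-cross x y = λ { 0F → minor 1F 2F ; 1F → minor 2F 0F ; 2F → minor 0F 1F }
    where
    minor : ∀ a b → ι (minorℤ x y a b) ≈ ι (x a) * ι (y b) - ι (x b) * ι (y a)
    minor a b = trans (ι-+ (x a ℤ.* y b) (ℤ.- (x b ℤ.* y a)))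
      (+-cong (ι-* (x a) (y b)) (trans (ι-neg (x b ℤ.* y a)) (-‿cong (ι-* (x b) (y a)))))

  -- The syntactic counterpart of `gram` at the base vectors, built so that its value unfolds to the
  -- same nested sum.
  gramᴾ : ∀ {k} → (Fin 6 → Polynomial k) → Fin 3 → Fin 3 → Polynomial k
  gramᴾ α a b = foldr _:+_ (con (+ 0)) (λ i → α i :* (con (vectorsℤ i a) :* con (vectorsℤ i b)))

  unitᴾ : ∀ {k n} → Fin n → Fin n → Polynomial k
  unitᴾ zero    zero    = con (+ 1)
  unitᴾ zero    (suc j) = con (+ 0)
  unitᴾ (suc i) zero    = con (+ 0)
  unitᴾ (suc i) (suc j) = unitᴾ i j

  base-tight : ∀ a b → gram (λ i → ι (+ suc (weightsℕ i))) base a b ≈ ι (+ 8) * unit a b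
  -- The entries are listed one by one because `refl` can compare the normal forms only for concrete
  -- indices.
  base-tight = λ where
      0F 0F → case 0F 0F refl
      0F 1F → case 0F 1F refl
      0F 2F → case 0F 2F refl
      1F 0F → case 1F 0F refl
      1F 1F → case 1F 1F refl
      1F 2F → case 1F 2F refl
      2F 0F → case 2F 0F refl
      2F 1F → case 2F 1F refl
      2F 2F → case 2F 2F refl
    where
    case : ∀ a b → _
    case a b = prove [] (gramᴾ (λ i → con (+ suc (weightsℕ i))) a b) (con (+ 8) :* unitᴾ a b)

  coefficientᴾ : Fin 6 → Polynomial 3
  coefficientᴾ i = k 0F :* (x :* x) :+ k 1F :* (y :* y) :+ k 2F :* (z :* z)
                :+ k (suc 2F) :* (x :* y) :+ k (suc (suc 2F)) :* (x :* z) :+ k (suc (suc (suc 2F))) :* (y :* z)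
    where
    x y z : Polynomial 3
    x = var 0F
    y = var 1F
    z = var 2F

    k : Fin 6 → Polynomial 3
    k j = con (coefficientsℤ i j)

  base-full : ∀ (x : Vector₃) → ∃[ d ] ∃[ α ] 0# < d × (∀ a b → gram α base a b ≈ d * (x a * x b))
  -- Taking the coefficients as values of polynomials in x turns each entry into a polynomial
  -- identity. The factor 8 clears the denominators.
  base-full x = ι (+ 8) , (λ i → ⟦ coefficientᴾ i ⟧ (tabulate x)) , 0<ι 7 , λ where
      0F 0F → case 0F 0F refl
      0F 1F → case 0F 1F refl
      0F 2F → case 0F 2F refl
      1F 0F → case 1F 0F refl
      1F 1F → case 1F 1F refl
      1F 2F → case 1F 2F refl
      2F 0F → case 2F 0F refl
      2F 1F → case 2F 1F refl
      2F 2F → case 2F 2F refl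
    where
    case : ∀ a b → _
    case a b = prove (tabulate x) (gramᴾ coefficientᴾ a b) (con (+ 8) :* (var a :* var b))

  baseConfiguration : Configuration base
  baseConfiguration = record
    { orthogonal    = λ i j i+1≡j → trans (ι-dot (vectorsℤ i) (vectorsℤ j)) (reflexive (≡.cong ι (orthogonalℤ i j i+1≡j)))
    ; nonorthogonal = λ i j i+1<j eq → ι-≉0 (nonorthogonalℤ i j i+1<j) (trans (sym (ι-dot (vectorsℤ i) (vectorsℤ j))) eq)
    ; nonparallel   = λ j eq → let a , ≢0 = nonparallelℤ j in
                        ι-≉0 ≢0 (trans (ι-cross (vectorsℤ zero) (vectorsℤ (suc j)) a) (eq a))
    ; size          = ι (+ 8)
    ; size-pos      = 0<ι 7
    ; weight        = λ i → ι (+ suc (weightsℕ i))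
    ; weight-pos    = λ i → 0<ι (weightsℕ i)
    ; tight         = base-tight
    ; full          = base-full
    }

  -- The index of `Configuration` is two less than the number of vectors, so these have 6 + m
  -- vectors.
  configuration : ∀ m → ∃ (Configuration {4 ℕ.+ m})
  configuration zero    = base , baseConfiguration
  configuration (suc m) = extend (configuration m)

-- From a configuration to an orthonormal triple with the required pattern

module TightFrames {c ℓ₁ ℓ₂} (ℝ : RealNumbers c ℓ₁ ℓ₂) where
  open OrderedField ℝ
  open LinearAlgebra ℝ
  open GenericVectors ℝ
  open Configurations ℝ
  open Orthonormal ℝ
  open LowerBound ℝ using (unit-≢)
  open import Relation.Binary.Reasoning.Setoid setoid

  record Frame (n : ℕ) : Set (c ⊔ ℓ₁) where
    field
      vectors       : Vector (Vector Carrier n) 3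
      orthonormal   : IsOrthonormal vectors
      realizes      : Realizes ℝ (complement (path n)) (Projection.P vectors orthonormal)

  module Normalized {n : ℕ} {u : Vector Vector₃ (2 ℕ.+ n)} (config : Configuration u)
    {r : Carrier} (0<r : 0# < r) (size-r : Configuration.size {n} {u} config * r ≈ 1#)
    (k : Vector Carrier (2 ℕ.+ n))
    (k²≈ : ∀ (i : Fin (2 ℕ.+ n)) → k i * k i ≈ Configuration.weight {n} {u} config i * r) where
    open Configuration config

    k≉0 : ∀ i → k i ≉ 0#
    k≉0 i k≈0 = >⇒≉ (*-pos (weight-pos i) 0<r) (trans (sym (k²≈ i)) (trans (*-congʳ k≈0) (zeroˡ (k i))))

    -- The transpose of the family kᵢ uᵢ. Tightness says that these three rows are orthonormal, and
    -- their projection is the Gram matrix of the kᵢ uᵢ.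
    coordinate : Vector (Vector Carrier (2 ℕ.+ n)) 3
    coordinate a i = k i * u i a

    coordinate-orthonormal : IsOrthonormal coordinate
    coordinate-orthonormal a b = begin
      sum (λ i → k i * u i a * (k i * u i b))
        ≈⟨ sum-cong-≋ (λ i → solve 3 (λ k x y → k :* x :* (k :* y) := k :* k :* (x :* y)) refl (k i) (u i a) (u i b)) ⟩
      sum (λ i → k i * k i * (u i a * u i b))
        ≈⟨ sum-cong-≋ (λ i → trans (*-congʳ (trans (k²≈ i) (*-comm (weight i) r))) (*-assoc r (weight i) (u i a * u i b))) ⟩
      sum (λ i → r * (weight i * (u i a * u i b)))
        ≈⟨ *-distribˡ-sum r (λ i → weight i * (u i a * u i b)) ⟨
      r * gram weight u a b
        ≈⟨ *-congˡ (tight a b) ⟩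
      r * (size * unit a b)
        ≈⟨ solve 3 (λ r s e → r :* (s :* e) := (s :* r) :* e) refl r size (unit a b) ⟩
      size * r * unit a b
        ≈⟨ trans (*-congʳ size-r) (*-identityˡ (unit a b)) ⟩
      unit a b ∎

    open Projection coordinate coordinate-orthonormal using (P; P-symmetric)

    P-entry : ∀ i j → P i j ≈ k i * k j * dot (u i) (u j)
    P-entry i j = trans
      (sum-cong-≋ (λ a → solve 4 (λ k l x y → k :* x :* (l :* y) := k :* l :* (x :* y)) refl (k i) (k j) (u i a) (u j a)))
      (sym (*-distribˡ-sum (k i * k j) (λ a → u i a * u j a)))

    path-orthogonal : ∀ {i j} → SimpleGraph.Adj (path (2 ℕ.+ n)) i j → dot (u i) (u j) ≈ 0#
    path-orthogonal {i} {j} (inj₁ i+1≡j) = orthogonal i j i+1≡j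
    path-orthogonal {i} {j} (inj₂ j+1≡i) = trans (dot-comm (u i) (u j)) (orthogonal j i j+1≡i)

    complement-nonorthogonal : ∀ {i j} → SimpleGraph.Adj (complement (path (2 ℕ.+ n))) i j → dot (u i) (u j) ≉ 0#
    complement-nonorthogonal {i} {j} (i≢j , ¬adj) with ℕ.<-cmp (toℕ i) (toℕ j)
    ... | tri< i<j _ _ = nonorthogonal i j (ℕ.≤∧≢⇒< i<j (¬adj ∘ inj₁))
    ... | tri≈ _ i≡j _ = contradiction (Fin.toℕ-injective i≡j) i≢j
    ... | tri> _ _ j<i = λ eq → nonorthogonal j i (ℕ.≤∧≢⇒< j<i (¬adj ∘ inj₂)) (trans (dot-comm (u j) (u i)) eq)

    normalized : Frame (2 ℕ.+ n)
    normalized = record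
      { vectors     = coordinate
      ; orthonormal = coordinate-orthonormal
      ; realizes    = record
        { symmetric = P-symmetric
        ; pattern-⇔ = λ i j i≢j → mk⇔
            (λ Pij≉0 → i≢j , λ adj → Pij≉0 (trans (P-entry i j) (trans (*-congˡ (path-orthogonal adj)) (zeroʳ (k i * k j)))))
            (λ adj Pij≈0 → *-≉0 (*-≉0 (k≉0 i) (k≉0 j)) (complement-nonorthogonal adj) (trans (sym (P-entry i j)) Pij≈0))
        }
      }

  frame : ∀ {n} {u : Vector Vector₃ (2 ℕ.+ n)} → Configuration u → Frame (2 ℕ.+ n)
  frame config =
    let r , 0<r , size-r = inverse-pos size-pos
        -- kᵢ² is the weight divided by the size; this is where the weights have to be positive.
        scaling i        = sqrt (*-pos (weight-pos i) 0<r)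
    in Normalized.normalized config 0<r size-r (λ i → proj₁ (scaling i)) (λ i → proj₂ (scaling i))
    where open Configuration config

-- Both formulations of the result for 6 + m vertices

module Main {c ℓ₁ ℓ₂} (ℝ : RealNumbers c ℓ₁ ℓ₂) where
  open OrderedField ℝ using (refl)
  open Spectral ℝ
  open LowerBound ℝ
  open Orthonormal ℝ
  open BaseConfiguration ℝ
  open TightFrames ℝ

  RankThreeProjection SmallProjection : ℕ → Set _
  RankThreeProjection n =
    ∃[ P ] Realizes ℝ (complement (path n)) P × IsOrthogonalProjection ℝ P × HasRank ℝ P 3
  SmallProjection n =
    ∃[ P ] Realizes ℝ (complement (path n)) P × IsOrthogonalProjection ℝ P × (HasRank ℝ P 1 ⊎ HasRank ℝ P 2)

  module _ {m} (F : Frame (6 ℕ.+ m)) where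
    open Frame F
    open Projection vectors orthonormal

    rank-three-projection : RankThreeProjection (6 ℕ.+ m)
    rank-three-projection = P , realizes , isOrthogonalProjection , hasRank

    achievable-three : Achievable ℝ (complement (path (6 ℕ.+ m))) 3
    achievable-three = ℕ.s≤s ℕ.z≤n , ℕ.s≤s (ℕ.s≤s (ℕ.s≤s ℕ.z≤n)) , P , realizes , spectrum ,
      distinctEigenvalues ≡.refl ≡.refl , multiplicity-0 ≡.refl , multiplicity-1

    q≡2 : IsQ ℝ (complement (path (6 ℕ.+ m))) 2
    q≡2 = (P , realizes , spectrum , distinctEigenvalues ≡.refl ≡.refl) , λ k (A , A-realizes , spectrum-A) →
      -- Vertices 0 and 2 are not consecutive, so the entry between them is nonzero and off the
      -- diagonal.
      two-distinct-eigenvalues {A = A} (Realizes.symmetric A-realizes) {zero} {suc (suc zero)} refl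
        (nonconsecutive⇒≉0 A-realizes {zero} {suc (suc zero)} (λ ()) λ { (inj₁ ()) ; (inj₂ ()) }) spectrum-A

    MB≡3 : IsMB ℝ (complement (path (6 ℕ.+ m))) 3
    MB≡3 = q≡2 , achievable-three , λ k → achievable⇒≥3

  no-small-projection : ∀ {m} → ¬ SmallProjection (6 ℕ.+ m)
  no-small-projection {m} (P , realizes , projection , inj₁ rank) =
    contradiction (rank≥3 {n = suc m} {P = P} realizes projection rank) λ { (ℕ.s≤s ()) }
  no-small-projection {m} (P , realizes , projection , inj₂ rank) =
    contradiction (rank≥3 {n = suc m} {P = P} realizes projection rank) λ { (ℕ.s≤s (ℕ.s≤s ())) }

  tight-frame : ∀ m → Frame (6 ℕ.+ m)
  tight-frame m = frame (proj₂ (configuration m))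

open import Data.Nat.Base using (_≤_)

theorem1p1 : ∀ {c ℓ₁ ℓ₂} (ℝ : RealNumbers c ℓ₁ ℓ₂) →
    (∀ n → 6 ≤ n → IsMB ℝ (complement (path n)) 3)
    × (∀ n → 6 ≤ n →
    (∃[ P ] Realizes ℝ (complement (path n)) P × IsOrthogonalProjection ℝ P × HasRank ℝ P 3)
    × ¬ (∃[ P ] Realizes ℝ (complement (path n)) P × IsOrthogonalProjection ℝ P
    × (HasRank ℝ P 1 ⊎ HasRank ℝ P 2)))
theorem1p1 ℝ =
    (λ n → from-6 (λ n → IsMB ℝ (complement (path n)) 3) λ m → MB≡3 (tight-frame m))
  , (λ n 6≤n → from-6 RankThreeProjection (λ m → rank-three-projection (tight-frame m)) 6≤n
             , from-6 (λ n → ¬ SmallProjection n) (λ m → no-small-projection) 6≤n)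
  where
  open Main ℝ

  from-6 : ∀ {p} (T : ℕ → Set p) → (∀ m → T (6 ℕ.+ m)) → ∀ {n} → 6 ≤ n → T n
  from-6 T t 6≤n with ℕ.m≤n⇒∃[o]m+o≡n 6≤n
  ... | m , ≡.refl = t m
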